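{- Let $R$ be a conditional equational theory over $\Sigma^*$ that is finitely saturated under $\mathfrak{S}$ (i.e. $R$ is a finite set of conditional equations saturated under $\mathfrak{S}$). Then the word problems w.r.t. $R$ are decidable by Rewrite together with Equality Resolution: for all $s,t\in\Sigma^*$, exhaustively applying Rewrite and Equality Resolution starting from $R\cup\{s\not\approx t\}$ (inferences with all premises in $R$ being redundant and not performed) terminates, and it produces the empty clause if and only if $R\models s\approx t$.
   Context: **Strings and clauses.** $\Sigma$ is a finite alphabet with a total precedence, $\Sigma^*$ is the set of strings over $\Sigma$, $\lambda$ is the empty string. An equation is $s\approx t$ with $s,t\in\Sigma^*$ (unoriented: $s\approx t$ and $t\approx s$ are identified, likewise $s\not\approx t$ and $t\not\approx s$). A literal is an equation $s\approx t$ (positive) or a negated equation $s\not\approx t$ (negative). A clause over $\Sigma^*$ is a finite multiset of literals, written as a disjunction; $\square$ is the empty clause. A conditional equation is a clause $(s_1\approx t_1\wedge\cdots\wedge s_n\approx t_n)\rightarrow l\approx r$, $n\ge 0$, i.e. the clause $s_1\not\approx t_1\vee\cdots\vee s_n\not\approx t_n\vee l\approx r$. A conditional equational theory is a set of conditional equations. $\succ$ is the length-lexicographic ordering on $\Sigma^*$: $s\succ t$ iff $|s|>|t|$, or $|s|=|t|$ and $s$ is larger than $t$ in the lexicographic order induced by the precedence. $\bowtie$ denotes either $\approx$ or $\not\approx$. **Selection.** A fixed selection function selects (arbitrarily) exactly one negative literal in each clause containing at least one negative literal. **Inference system $\mathfrak{S}$.** It consists of the following rules. - Superposition: from $C\vee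 u_1u_2\approx s$ and $D\vee u_2u_3\approx t$ infer $C\vee D\vee u_1t\approx su_3$, if $u_2\neq\lambda$, $C$ and $D$ contain no selected literal, $u_1u_2\succ s$, $u_2u_3\succ t$. - Rewrite: from $C\vee u_1u_2u_3\bowtie s$ and $D\vee u_2\approx t$ infer $C\vee D\vee u_1tu_3\bowtie s$, if $u_1u_2u_3\bowtie s$ is selected in the left premise whenever $\bowtie$ is $\not\approx$, $C$ contains no selected literal whenever $\bowtie$ is $\approx$, $D$ contains no selected literal, $u_2\succ t$. - Equality Resolution: from $C\vee s\not\approx s$ infer $C$, if $s\not\approx s$ is selected in the premise. - Paramodulation: from $C\vee s\approx u_1u_2$ and $D\vee u_2u_3\approx t$ infer $C\vee D\vee su_3\approx u_1t$, if $u_2\ne\lambda$, $C$ contains no selected literal, $C$ contains a positive literal, $D$ contains no selected literal, $s\succ u_1u_2$, $u_2u_3\succ t$. - Factoring: from $C\vee s\approx t\vee su\approx tu$ infer $C\vee su\approx tu$, if $C$ contains no selected literal. (The last two rules play no role for Horn clauses.) **$g$-terms and $g$-clauses.** $T(\Sigma\cup\{\bot\})$ is the set of ground terms with each letter of $\Sigma$ a unary function symbol and $\bot$ the only constant; its elements ($g$-terms) are written as strings $u\bot$ with $u\in\Sigma^*$. For a clause $C=s_1\approx t_1\vee\cdots\vee s_m\approx t_m\vee u_1\not\approx v_1\vee\cdots\vee u_n\not\approx v_n$ over $\Sigma^*$, a $g$-clause of $C$ is any $s_1w_1\bot\approx t_1w_1\bot\vee\cdots\vee s_mw_m\bot\approx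 t_mw_m\bot\vee u_1\bot\not\approx v_1\bot\vee\cdots\vee u_n\bot\not\approx v_n\bot$ with $w_1,\ldots,w_m\in\Sigma^*$. $\succ_g$ is the length-lexicographic ordering on $g$-terms (precedence on $\Sigma$ extended with $\bot$ minimal), extended to literals and clauses by multiset extension, where $s\approx t$ is identified with $\{\{s\},\{t\}\}$, $s\not\approx t$ with $\{\{s,t\}\}$, and a clause with the multiset of its literals. **Semantics.** An (equality Herbrand) interpretation is a congruence $I$ on $T(\Sigma\cup\{\bot\})$ (the one generated by some set of equations between $g$-terms). It satisfies a $g$-clause if some positive literal $p\approx q$ of it has $(p,q)\in I$ or some negative literal $p\not\approx q$ has $(p,q)\notin I$. $I$ satisfies a clause over $\Sigma^*$ if it satisfies all its $g$-clauses, and a set of clauses if it satisfies every member. $R\models s\approx t$ means every interpretation satisfying $R$ satisfies $s\approx t$. For $g$-clauses, $\{C_1,\ldots,C_k\}\models C$ means every interpretation satisfying all $C_i$ satisfies $C$. **$g$-instances, redundancy, saturation.** A $g$-instance of an inference $\pi$ of $\mathfrak{S}$ with premises $C_1,\ldots,C_k$ and conclusion $D$ is an inference of $\mathfrak{S}$ with premises $C_1',\ldots,C_k'$ and conclusion $D'$ that are $g$-clauses of $C_1,\ldots,C_k,D$; here $g$-terms are viewed as strings over $\Sigma\cup\{\bot\}$, $\succ_g$ is used in place of $\succ$, all terms occurring must be $g$-terms, and a negative literal of $C_i'$ is selected iff the literal of $C_i$ it comes from is. An inference $\pi$ is redundant w.r.t. a set $S$ of clauses if for every $g$-instance of $\pi$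 with maximal premise $C'$ (w.r.t. $\succ_g$) and conclusion $D'$ there are $g$-clauses $C_1',\ldots,C_k'$ ($k\ge0$) of clauses in $S$ with $\{C_1',\ldots,C_k'\}\models D'$ and $C'\succ_g C_i'$ for all $i$. $S$ is saturated under $\mathfrak{S}$ if every inference of $\mathfrak{S}$ with premises in $S$ is redundant w.r.t. $S$. **Word problems.** For $s,t\in\Sigma^*$, the word problem $s\approx^?t$ w.r.t. $R$ asks whether $R\models s\approx t$; its goal is the clause $s\not\approx t$. -}

module Defs where

open import Data.Fin.Base using (Fin)
open import Data.List.Base using (List; []; _∷_; _++_; length; map; foldr; zipWith)
open import Data.List.Membership.Propositional using (_∈_)
open import Data.List.Relation.Binary.Lex.Strict using (Lex-<)
open import Data.List.Relation.Binary.Pointwise using (Pointwise)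
open import Data.List.Relation.Unary.All using (All)
open import Data.List.Relation.Unary.Any using (Any)
open import Data.Maybe as Maybe using (Maybe; just; Is-just)
import Data.Maybe.Relation.Binary.Pointwise as MaybeR
import Data.Maybe.Relation.Unary.Any as MaybeU
open import Data.Nat.Base as ℕ using (ℕ)
open import Data.Product.Base using (∃-syntax; _×_; _,_)
open import Data.Sum.Base using (_⊎_)
open import Function.Bundles using (_↔_)
open import Induction.WellFounded using (Acc)
open import Level using (0ℓ)
open import Relation.Binary.Bundles using (Setoid)
open import Relation.Binary.Construct.Add.Infimum.Strict using (_<₋_)
open import Relation.Binary.Construct.Closure.ReflexiveTransitive using (Star)
open import Relation.Binary.Core using (Rel)
open import Relation.Binary.PropositionalEquality using (_≡_; _≢_; setoid)
open import Relation.Binary.Rewriting using (IsNormalForm)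
open import Relation.Binary.Structures using (IsEquivalence; IsStrictTotalOrder)
open import Relation.Nullary.Construct.Add.Infimum using (_₋; ⊥₋; [_])
open import Relation.Nullary.Negation using (¬_)
open import Relation.Unary using (Pred)

import Data.List.Membership.Setoid as SetoidMembership
import Data.List.Relation.Binary.Permutation.Setoid as Permutation

------------------------------------------------------------------------
-- Alphabets and orderings

record Alphabet : Set₁ where
  infix 4 _<_
  field
    Letter             : Set
    size               : ℕ
    finite             : Letter ↔ Fin size
    _<_                : Rel Letter 0ℓ
    isStrictTotalOrder : IsStrictTotalOrder _≡_ _<_

LengthLex : {B : Set} → Rel B 0ℓ → Rel (List B) 0ℓ
LengthLex _<_ s t =
  (length t ℕ.< length s) ⊎ (length s ≡ length t × Lex-< _≡_ _<_ t s)

-- Finite multisets are lists up to permutation.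

multiset : Setoid 0ℓ 0ℓ → Setoid 0ℓ 0ℓ
multiset S = Permutation.↭-setoid S

-- The Dershowitz–Manna extension: N arises from M by replacing a nonempty
-- submultiset X by a finite multiset Y each of whose elements is below one of X.

MultisetExt : (S : Setoid 0ℓ 0ℓ) (let A = Setoid.Carrier S) →
              Rel A 0ℓ → Rel (List A) 0ℓ
MultisetExt S _≻_ M N =
  ∃[ X ] ∃[ Y ] ∃[ Z ]
    X ≢ [] × M ↭ X ++ Z × N ↭ Y ++ Z × All (λ y → Any (_≻ y) X) Y
  where open Permutation S using (_↭_)

------------------------------------------------------------------------
-- Literals and clauses

data Polarity : Set where
  positive negative : Polarity

data Literal (T : Set) : Set where
  literal : Polarity → T → T → Literal T

infix 4 _≈_ _≉_
pattern _≈_ s t = literal positive s t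
pattern _≉_ s t = literal negative s t

data Positive {T : Set} : Pred (Literal T) 0ℓ where
  positive : ∀ {s t} → Positive (s ≈ t)

data Negative {T : Set} : Pred (Literal T) 0ℓ where
  negative : ∀ {s t} → Negative (s ≉ t)

-- Equations are unoriented.

infix 4 _≅_
data _≅_ {T : Set} : Rel (Literal T) 0ℓ where
  same : ∀ {p s t} → literal p s t ≅ literal p s t
  flip : ∀ {p s t} → literal p s t ≅ literal p t s

≅-isEquivalence : ∀ {T} → IsEquivalence (_≅_ {T})
≅-isEquivalence = record
  { refl  = λ { {literal _ _ _} → same }
  ; sym   = λ { same → same ; flip → flip }
  ; trans = λ { same q → q ; flip same → flip ; flip flip → same }
  }

literalSetoid : Set → Setoid 0ℓ 0ℓ
literalSetoid T = record { isEquivalence = ≅-isEquivalence {T} }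

Clause : Set → Set
Clause T = List (Literal T)

clauseSetoid : Set → Setoid 0ℓ 0ℓ
clauseSetoid T = multiset (literalSetoid T)

infix 3 _≋_
_≋_ : ∀ {T} → Rel (Clause T) 0ℓ
_≋_ {T} = Setoid._≈_ (clauseSetoid T)

infix 4 _∈ˡ_ _∈ᶜ_ _∉ᶜ_
_∈ˡ_ : ∀ {T} → Literal T → Clause T → Set
_∈ˡ_ {T} = SetoidMembership._∈_ (literalSetoid T)

_∈ᶜ_ _∉ᶜ_ : ∀ {T} → Clause T → List (Clause T) → Set
_∈ᶜ_ {T} = SetoidMembership._∈_ (clauseSetoid T)
C ∉ᶜ N   = ¬ (C ∈ᶜ N)

mapLiteral : {T U : Set} → (T → U) → Literal T → Literal U
mapLiteral f (literal p s t) = literal p (f s) (f t)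

mapClause : {T U : Set} → (T → U) → Clause T → Clause U
mapClause f = map (mapLiteral f)

conditional : ∀ {T} → List (T × T) → T → T → Clause T
conditional conditions l r = (l ≈ r) ∷ map (λ { (s , t) → s ≉ t }) conditions

IsConditionalEquation : ∀ {T} → Pred (Clause T) 0ℓ
IsConditionalEquation C = ∃[ conditions ] ∃[ l ] ∃[ r ] C ≋ conditional conditions l r

------------------------------------------------------------------------
-- The inference system

-- A premise carries its selected literal, if there is one.  Selection is of
-- a literal rather than of one of its occurrences.  The rules do not see the
-- difference: where the side literals C of a premise must contain no selected
-- literal, the other literals of that premise are positive.

Premise : Set → Set
Premise T = Clause T × Maybe (Literal T)

data Rule : Set where
  Superposition Rewrite EqualityResolution Paramodulation Factoring : Rule

module Inferences {B : Set} (_≻_ : Rel (List B) 0ℓ) where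

  Selected : Maybe (Literal (List B)) → Pred (Literal (List B)) 0ℓ
  Selected σ L = MaybeU.Any (L ≅_) σ

  NoneSelected : Maybe (Literal (List B)) → Pred (Clause (List B)) 0ℓ
  NoneSelected σ C = ¬ Any (Selected σ) C

  data Infer : Rule → List (Premise (List B)) → Clause (List B) → Set where

    superposition : ∀ {P Q E σ τ C D u₁ u₂ u₃ s t} →
      P ≋ (u₁ ++ u₂ ≈ s) ∷ C →
      Q ≋ (u₂ ++ u₃ ≈ t) ∷ D →
      E ≋ (u₁ ++ t ≈ s ++ u₃) ∷ C ++ D →
      u₂ ≢ [] →
      NoneSelected σ C → NoneSelected τ D →
      (u₁ ++ u₂) ≻ s → (u₂ ++ u₃) ≻ t →
      Infer Superposition ((P , σ) ∷ (Q , τ) ∷ []) E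

    rewriting : ∀ {P Q E σ τ C D u₁ u₂ u₃ s t} (⋈ : Polarity) →
      P ≋ literal ⋈ (u₁ ++ u₂ ++ u₃) s ∷ C →
      Q ≋ (u₂ ≈ t) ∷ D →
      E ≋ literal ⋈ (u₁ ++ t ++ u₃) s ∷ C ++ D →
      (⋈ ≡ negative → Selected σ (literal ⋈ (u₁ ++ u₂ ++ u₃) s)) →
      (⋈ ≡ positive → NoneSelected σ C) →
      NoneSelected τ D →
      u₂ ≻ t →
      Infer Rewrite ((P , σ) ∷ (Q , τ) ∷ []) E

    equalityResolution : ∀ {P E σ s} →
      P ≋ (s ≉ s) ∷ E →
      Selected σ (s ≉ s) →
      Infer EqualityResolution ((P , σ) ∷ []) E

    paramodulation : ∀ {P Q E σ τ C D u₁ u₂ u₃ s t} →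
      P ≋ (s ≈ u₁ ++ u₂) ∷ C →
      Q ≋ (u₂ ++ u₃ ≈ t) ∷ D →
      E ≋ (s ++ u₃ ≈ u₁ ++ t) ∷ C ++ D →
      u₂ ≢ [] →
      NoneSelected σ C → Any Positive C → NoneSelected τ D →
      s ≻ (u₁ ++ u₂) → (u₂ ++ u₃) ≻ t →
      Infer Paramodulation ((P , σ) ∷ (Q , τ) ∷ []) E

    factoring : ∀ {P E σ C s t u} →
      P ≋ (s ≈ t) ∷ (s ++ u ≈ t ++ u) ∷ C →
      E ≋ (s ++ u ≈ t ++ u) ∷ C →
      NoneSelected σ C →
      Infer Factoring ((P , σ) ∷ []) E

------------------------------------------------------------------------

module Calculus (𝒜 : Alphabet) where

  open Alphabet 𝒜

  Str : Set
  Str = List Letter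

  infix 4 _≻_
  _≻_ : Rel Str 0ℓ
  _≻_ = LengthLex _<_

  record SelectionFunction : Set where
    field
      select      : Clause Str → Maybe (Literal Str)
      select-cong : ∀ {C D} → C ≋ D → MaybeR.Pointwise _≅_ (select C) (select D)
      sound       : ∀ {C L} → select C ≡ just L → Negative L × L ∈ˡ C
      total       : ∀ {C} → Any Negative C → Is-just (select C)

  ----------------------------------------------------------------------
  -- Ground terms and g-clauses

  infixr 5 _·_
  data GTerm : Set where
    ⊥ᵍ  : GTerm
    _·_ : Letter → GTerm → GTerm

  _⊥ : Str → GTerm
  u ⊥ = foldr _·_ ⊥ᵍ u

  -- A g-term as a string over the alphabet extended by a least letter ⊥₋.

  string : GTerm → List (Letter ₋)
  string ⊥ᵍ      = ⊥₋ ∷ []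
  string (a · p) = [ a ] ∷ string p

  data IsGLiteralOf : Literal GTerm → Literal Str → Set where
    positive : ∀ {s t} w → IsGLiteralOf ((s ++ w) ⊥ ≈ (t ++ w) ⊥) (s ≈ t)
    negative : ∀ {u v} → IsGLiteralOf (u ⊥ ≉ v ⊥) (u ≉ v)

  IsGClauseOf : Clause GTerm → Clause Str → Set
  IsGClauseOf = Pointwise IsGLiteralOf

  infix 4 _≻ˢ_ _≻ᵗ_ _≻ᵍ_
  _≻ˢ_ : Rel (List (Letter ₋)) 0ℓ
  _≻ˢ_ = LengthLex (_<₋_ _<_)

  _≻ᵗ_ : Rel GTerm 0ℓ
  p ≻ᵗ q = string p ≻ˢ string q

  literalMultiset : Literal GTerm → List (List GTerm)
  literalMultiset (s ≈ t) = (s ∷ []) ∷ (t ∷ []) ∷ []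
  literalMultiset (s ≉ t) = (s ∷ t ∷ []) ∷ []

  _≻ᵍ_ : Rel (Clause GTerm) 0ℓ
  C ≻ᵍ D = MultisetExt literals
             (MultisetExt sides (MultisetExt terms _≻ᵗ_))
             (map literalMultiset C) (map literalMultiset D)
    where
    terms    = setoid GTerm
    sides    = multiset terms
    literals = multiset sides

  ----------------------------------------------------------------------
  -- Semantics

  record Interpretation : Set₁ where
    field
      _~_           : Rel GTerm 0ℓ
      isEquivalence : IsEquivalence _~_
      ·-cong        : ∀ a {p q} → p ~ q → (a · p) ~ (a · q)

  module _ (I : Interpretation) where
    open Interpretation I

    data Holds : Pred (Literal GTerm) 0ℓ where
      positive : ∀ {p q} → p ~ q → Holds (p ≈ q)
      negative : ∀ {p q} → ¬ (p ~ q) → Holds (p ≉ q)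

    SatisfiesG : Pred (Clause GTerm) 0ℓ
    SatisfiesG = Any Holds

    Satisfies : Pred (Clause Str) 0ℓ
    Satisfies C = ∀ G → IsGClauseOf G C → SatisfiesG G

  infix 3 _⊨ᵍ_ _⊨_
  _⊨ᵍ_ : List (Clause GTerm) → Clause GTerm → Set₁
  Gs ⊨ᵍ H = ∀ I → All (SatisfiesG I) Gs → SatisfiesG I H

  _⊨_ : Pred (Clause Str) 0ℓ → Clause Str → Set₁
  S ⊨ D = ∀ I → (∀ C → S C → Satisfies I C) → Satisfies I D

  ----------------------------------------------------------------------
  -- Inferences, redundancy, saturation

  open Inferences _≻_ public
  open Inferences _≻ˢ_ public using () renaming (Infer to InferG)

  module WithSelection (selection : SelectionFunction) where
    open SelectionFunction selection

    premise : Clause Str → Premise Str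
    premise C = C , select C

    -- The selected literal of a g-clause G of C is the one that comes from
    -- the selected literal of C; it is negative, so it is obtained by ⊥ alone.

    premiseG : Clause Str → Clause GTerm → Premise (List (Letter ₋))
    premiseG C G = mapClause string G , Maybe.map (mapLiteral λ u → string (u ⊥)) (select C)

    record IsGInstance (Cs : List (Clause Str)) (D : Clause Str)
                       (Gs : List (Clause GTerm)) (H : Clause GTerm) : Set where
      field
        {rule}     : Rule
        premises   : Pointwise IsGClauseOf Gs Cs
        conclusion : IsGClauseOf H D
        inference  : InferG rule (zipWith premiseG Cs Gs) (mapClause string H)

    IsMaximalIn : Clause GTerm → List (Clause GTerm) → Set
    IsMaximalIn G Gs = G ∈ Gs × All (λ G′ → ¬ (G′ ≻ᵍ G)) Gs

    Redundant : Pred (Clause Str) 0ℓ → List (Clause Str) → Clause Str → Set₁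
    Redundant S Cs D =
      ∀ {Gs H G} → IsGInstance Cs D Gs H → IsMaximalIn G Gs →
      ∃[ Fs ] All (λ F → ∃[ C ] S C × IsGClauseOf F C) Fs
            × (Fs ⊨ᵍ H)
            × All (G ≻ᵍ_) Fs

    Saturated : Pred (Clause Str) 0ℓ → Set₁
    Saturated S = ∀ {rule Cs D} →
      All S Cs → Infer rule (map premise Cs) D → Redundant S Cs D

    --------------------------------------------------------------------
    -- Deciding word problems

    -- One step adds a new clause to the current set of clauses N.

    data Step (R N : List (Clause Str)) : List (Clause Str) → Set where
      step : ∀ {rule Cs D} →
        rule ≡ Rewrite ⊎ rule ≡ EqualityResolution →
        All (_∈ᶜ N) Cs →
        ¬ All (_∈ᶜ R) Cs →
        Infer rule (map premise Cs) D →
        D ∉ᶜ N →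
        Step R N (D ∷ N)

    start : List (Clause Str) → Str → Str → List (Clause Str)
    start R s t = ((s ≉ t) ∷ []) ∷ R

    Terminates : List (Clause Str) → Str → Str → Set
    Terminates R s t = Acc (λ N′ N → Step R N N′) (start R s t)

    -- N is the result of an exhaustive application of the two rules.

    Result : List (Clause Str) → Str → Str → Pred (List (Clause Str)) 0ℓ
    Result R s t N = Star (Step R) (start R s t) N × IsNormalForm (Step R) N

{-# OPTIONS --safe #-}

-- A goal clause can only be rewritten by unit equations of R: the clause that
-- supplies the equation must have no selected literal, hence no conditions.
-- So goals stay of the form u ≉ v and never grow in length, which bounds the
-- search; what remains is that s and t are joinable by the oriented unit
-- equations whenever R ⊨ s ≈ t.
--
-- For this, take innermost rewriting that contracts each redex to its least
-- contractum.  It is deterministic, hence confluent, and its equivalence closure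
-- is a congruence on g-terms.  Every g-clause of R holds in this congruence, by
-- well-founded induction on ≻ᵍ: if a unit equation l w ≈ r w is not itself the
-- rewrite step at l w, the step overlaps it, and the redundancy of the
-- corresponding Superposition or Rewrite inference joins the two results using
-- smaller g-clauses; if a condition is selected, Rewrite and Equality Resolution
-- are used in the same way.

module Submission where

open import Defs
open import Data.Fin.Induction using (spo-wellFounded)
open import Data.List.Base using (List; []; _∷_; _++_; length; map; concatMap; allFin; cartesianProductWith)
open import Data.List.Membership.Propositional using (_∈_; lose; find)
import Data.List.Membership.Propositional.Properties as ∈
import Data.List.Membership.Setoid as SetoidMembership
import Data.List.Membership.Setoid.Properties as Membershipₚ
open import Data.List.Properties using (++-assoc; ++-identityʳ; length-++; ≡-dec; ∷-injective; ++-cancelˡ)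
open import Data.List.Relation.Binary.Lex.Strict as Lex using (Lex-<; base; halt; this; next)
import Data.List.Relation.Binary.Permutation.Setoid as Permutation
import Data.List.Relation.Binary.Permutation.Setoid.Properties as Permutationₚ
open import Data.List.Relation.Binary.Pointwise using (Pointwise; []; _∷_; Pointwise-≡⇒≡)
open import Data.List.Relation.Unary.All as All using (All; []; _∷_)
open import Data.List.Relation.Unary.Any as Any using (Any; here; there)
import Data.List.Relation.Unary.Any.Properties as Any
open import Data.Maybe as Maybe using (Maybe; just; nothing; Is-just)
import Data.Maybe.Relation.Unary.Any as MaybeU
open import Data.Nat.Base as ℕ using (ℕ; zero; suc)
import Data.Nat.Induction as ℕ
import Data.Nat.Properties as ℕₚ
open import Data.Product.Base using (_×_; ∃; ∃-syntax; _,_; proj₁; proj₂)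
open import Data.Product.Relation.Binary.Lex.Strict using (×-wellFounded)
open import Data.Sum.Base using (_⊎_; inj₁; inj₂)
open import Function.Base using (_∘_; id; case_of_) renaming (flip to converse)
open import Function.Bundles using (Inverse; Equivalence; _⇔_; mk⇔)
open import Induction.WellFounded using (Acc; acc; WellFounded; module Subrelation; wf⇒asym)
open import Level using (0ℓ)
open import Relation.Binary.Bundles using (Setoid)
open import Relation.Binary.Construct.Add.Infimum.Strict using (_<₋_; <₋-wellFounded; ⊥₋<[_]; [_])
open import Relation.Binary.Construct.Closure.Equivalence as EqClosure using (EqClosure)
open import Relation.Binary.Construct.Closure.ReflexiveTransitive as Star using (Star; ε; _◅_; _◅◅_)
open import Relation.Binary.Construct.Closure.Symmetric using (fwd; bwd)
import Relation.Binary.Construct.On as On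
open import Relation.Binary.Core using (Rel; _⇒_)
open import Relation.Binary.Definitions
  using (Asymmetric; Decidable; DecidableEquality; Transitive; Trichotomous; tri<; tri≈; tri>; _Respectsˡ_)
open import Relation.Binary.PropositionalEquality as ≡
  using (_≡_; refl; _≢_; cong; cong₂; sym; trans; subst; subst₂; setoid; resp₂)
import Relation.Binary.Reasoning.Setoid as SetoidReasoning
open import Relation.Binary.Rewriting using (IsNormalForm; Deterministic; det⇒conf; conf⇒unf)
open import Relation.Binary.Structures using (IsEquivalence; IsStrictPartialOrder; IsStrictTotalOrder)
open import Relation.Nullary.Construct.Add.Infimum using ([_])
open import Relation.Nullary.Decidable.Core using (Dec; yes; no; map′; _×-dec_; _⊎-dec_; ¬?; decidable-stable)
open import Relation.Nullary.Negation using (¬_; contradiction)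

-- Well-foundedness of the multiset extension

module _ (S : Setoid 0ℓ 0ℓ) where
  open Setoid S using () renaming (_≈_ to _≈ˢ_; Carrier to A; refl to ≈-refl; sym to ≈-sym)
  open Permutation S
  open Permutationₚ S hiding (++-assoc; ++-identityʳ)
  open SetoidMembership S using () renaming (_∈_ to _∈ˢ_)

  ∈⇒↭∷ : ∀ {x xs} → x ∈ˢ xs → ∃[ ys ] xs ↭ x ∷ ys
  ∈⇒↭∷ x∈xs with ys , zs , y , x≈y , eq ← Membershipₚ.∈-∃++ S x∈xs =
    ys ++ zs , ↭-trans (↭-reflexive-≋ eq) (shift (≈-sym x≈y) ys zs)

  ∷↭++⁻ : ∀ {x ms} xs ys → x ∷ ms ↭ xs ++ ys →
          (∃[ xs′ ] xs ↭ x ∷ xs′ × ms ↭ xs′ ++ ys) ⊎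
          (∃[ ys′ ] ys ↭ x ∷ ys′ × ms ↭ xs ++ ys′)
  ∷↭++⁻ {x} xs ys p with Membershipₚ.∈-++⁻ S xs (∈-resp-↭ p (here ≈-refl))
  ... | inj₁ x∈xs with xs′ , q ← ∈⇒↭∷ x∈xs =
    inj₁ (xs′ , q , drop-∷ (↭-trans p (++⁺ʳ ys q)))
  ... | inj₂ x∈ys with ys′ , q ← ∈⇒↭∷ x∈ys =
    inj₂ (ys′ , q , drop-∷ (↭-trans p (↭-trans (++⁺ˡ xs q) (↭-shift xs ys′))))

  All-⊎⇒↭++ : ∀ {P Q : A → Set} {xs} → All (λ x → P x ⊎ Q x) xs →
              ∃[ ys ] ∃[ zs ] xs ↭ ys ++ zs × All P ys × All Q zs
  All-⊎⇒↭++ [] = [] , [] , ↭-refl , [] , []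
  All-⊎⇒↭++ (px ∷ pxs) with ys , zs , p , pys , qzs ← All-⊎⇒↭++ pxs with px
  ... | inj₁ h = _ ∷ ys , zs , ↭-prep _ p , h ∷ pys , qzs
  ... | inj₂ h = ys , _ ∷ zs , ↭-trans (↭-prep _ p) (↭-sym (↭-shift ys zs)) , pys , h ∷ qzs

  module _ (_≻_ : Rel A 0ℓ) where

    multisetExt-respˡ : MultisetExt S _≻_ Respectsˡ _↭_
    multisetExt-respˡ p (X , Y , Z , X≢[] , q , r) = X , Y , Z , X≢[] , ↭-trans (↭-sym p) q , r

    multisetExt-all : ∀ {M N} → M ≢ [] → All (λ y → Any (_≻ y) M) N → MultisetExt S _≻_ M N
    multisetExt-all {M} {N} M≢[] dom =
      M , N , [] , M≢[] , ↭-reflexive (sym (++-identityʳ M)) , ↭-reflexive (sym (++-identityʳ N)) , dom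

    module _ (≻-respˡ : _≻_ Respectsˡ _≈ˢ_) where

      private
        _≺ᵐ_ : Rel (List A) 0ℓ
        _≺ᵐ_ = converse (MultisetExt S _≻_)

        acc-resp-↭ : ∀ {M N} → M ↭ N → Acc _≺ᵐ_ M → Acc _≺ᵐ_ N
        acc-resp-↭ p (acc rs) = acc λ n → rs (multisetExt-respˡ (↭-sym p) n)

        acc-[] : Acc _≺ᵐ_ []
        acc-[] = acc λ { ([] , _ , _ , X≢[] , _) → contradiction refl X≢[]
                       ; (_ ∷ _ , _ , _ , _ , p , _) → contradiction (↭-sym p) ¬x∷xs↭[] }

        -- Inner induction, on the accessibility of `M`; the hypothesis `acc-smaller` comes from the
        -- outer induction on `x`. A step down from `x ∷ M` either keeps `x` and is a step on `M`,
        -- or replaces `x`. Then the new elements below `x` are added one at a time by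
        -- `acc-smaller`, and the others belong to a step on `M`.
        acc-∷ : ∀ {x M} → (∀ {y N} → x ≻ y → Acc _≺ᵐ_ N → Acc _≺ᵐ_ (y ∷ N)) →
                Acc _≺ᵐ_ M → Acc _≺ᵐ_ (x ∷ M)
        acc-∷ {x} {M} acc-smaller (acc rM) = acc below
          where
          acc-++ : ∀ {Y N} → All (x ≻_) Y → Acc _≺ᵐ_ N → Acc _≺ᵐ_ (Y ++ N)
          acc-++ []           accN = accN
          acc-++ (x≻y ∷ x≻ys) accN = acc-smaller x≻y (acc-++ x≻ys accN)

          rest : ∀ {X Y Z} → M ↭ X ++ Z → All (λ y → Any (_≻ y) X) Y → Acc _≺ᵐ_ (Y ++ Z)
          -- If `x` is the only replaced element, nothing else dominates, so `Y` is empty and `M`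
          -- itself remains.
          rest {[]}    p []  = acc-resp-↭ p (acc rM)
          rest {_ ∷ _} p dom = rM (_ , _ , _ , (λ ()) , p , ↭-refl , dom)

          below : ∀ {N} → N ≺ᵐ (x ∷ M) → Acc _≺ᵐ_ N
          below (X , Y , Z , X≢[] , p , q , dom) with ∷↭++⁻ X Z p
          ... | inj₂ (Z′ , r , p′) =
            acc-resp-↭ (↭-sym (↭-trans q (↭-trans (++⁺ˡ Y r) (↭-shift Y Z′))))
                       (acc-∷ acc-smaller (rM (X , Y , Z′ , X≢[] , p′ , ↭-refl , dom)))
          ... | inj₁ (X′ , r , p′)
            with Y₁ , Y₂ , s , x≻Y₁ , dom′ ←
                   All-⊎⇒↭++ (All.map (Any.toSum ∘ Any-resp-↭ ≻-respˡ r) dom) =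
            acc-resp-↭ (↭-sym (↭-trans q (↭-trans (++⁺ʳ Z s) (↭-reflexive (++-assoc Y₁ Y₂ Z)))))
                       (acc-++ x≻Y₁ (rest p′ dom′))

        acc-∷′ : ∀ {x M} → Acc (converse _≻_) x → Acc _≺ᵐ_ M → Acc _≺ᵐ_ (x ∷ M)
        acc-∷′ (acc rx) = acc-∷ (λ x≻y → acc-∷′ (rx x≻y))

      multisetExt-wellFounded : WellFounded (converse _≻_) → WellFounded (converse (MultisetExt S _≻_))
      multisetExt-wellFounded wf []      = acc-[]
      multisetExt-wellFounded wf (x ∷ M) = acc-∷′ (wf x) (multisetExt-wellFounded wf M)

-- The length-lexicographic ordering

module _ {B : Set} {_<_ : Rel B 0ℓ} where

  private
    _≻_ : Rel (List B) 0ℓ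
    _≻_ = LengthLex _<_

  lengthLex⇒length≤ : ∀ {s t} → s ≻ t → length t ℕ.≤ length s
  lengthLex⇒length≤ (inj₁ t<s)       = ℕₚ.<⇒≤ t<s
  lengthLex⇒length≤ (inj₂ (s≡t , _)) = ℕₚ.≤-reflexive (sym s≡t)

  lengthLex-++ˡ : ∀ u {s t} → s ≻ t → (u ++ s) ≻ (u ++ t)
  lengthLex-++ˡ []      s≻t = s≻t
  lengthLex-++ˡ (a ∷ u) s≻t with lengthLex-++ˡ u s≻t
  ... | inj₁ lt       = inj₁ (ℕ.s≤s lt)
  ... | inj₂ (eq , p) = inj₂ (cong suc eq , next refl p)

  lengthLex-++ʳ : ∀ {s t} w → s ≻ t → (s ++ w) ≻ (t ++ w)
  lengthLex-++ʳ {s} {t} w (inj₁ lt) rewrite length-++ s {w} | length-++ t {w} =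
    inj₁ (ℕₚ.+-monoˡ-< (length w) lt)
  lengthLex-++ʳ {s} {t} w (inj₂ (eq , p)) =
    inj₂ (trans (length-++ s) (trans (cong (ℕ._+ length w) eq) (sym (length-++ t))) , lex eq p)
    where
    -- Equal lengths exclude `halt`: appending `w` to a proper prefix could reverse the order.
    lex : ∀ {s t} → length s ≡ length t → Lex-< _≡_ _<_ t s → Lex-< _≡_ _<_ (t ++ w) (s ++ w)
    lex eq (this a<b)   = this a<b
    lex eq (next a≡b p) = next a≡b (lex (ℕₚ.suc-injective eq) p)

  lengthLex-trans : Transitive _<_ → Transitive _≻_
  lengthLex-trans <-trans (inj₁ p) q = inj₁ (ℕₚ.≤-<-trans (lengthLex⇒length≤ q) p)
  lengthLex-trans <-trans (inj₂ (e , p)) (inj₁ q) = inj₁ (subst (_ ℕ.<_) (sym e) q)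
  lengthLex-trans <-trans (inj₂ (e , p)) (inj₂ (f , q)) =
    inj₂ (trans e f , Lex.<-transitive ≡.isEquivalence (resp₂ _<_) <-trans q p)

  lengthLex-compare : Trichotomous _≡_ _<_ → ∀ s t → s ≻ t ⊎ s ≡ t ⊎ t ≻ s
  lengthLex-compare compare s t with ℕₚ.<-cmp (length s) (length t)
  ... | tri< lt _ _ = inj₂ (inj₂ (inj₁ lt))
  ... | tri> _ _ gt = inj₁ (inj₁ gt)
  ... | tri≈ _ eq _ with Lex.<-compare sym compare s t
  ...   | tri< lt _ _ = inj₂ (inj₂ (inj₂ (sym eq , lt)))
  ...   | tri≈ _ s≡t _ = inj₂ (inj₁ (Pointwise-≡⇒≡ s≡t))
  ...   | tri> _ _ gt = inj₁ (inj₂ (eq , gt))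

  -- Lexicographic comparison alone may descend forever (b, ab, aab, ...), so it is restricted to
  -- words of one length and placed below the comparison of lengths.
  lengthLex-wellFounded : WellFounded _<_ → WellFounded (converse _≻_)
  lengthLex-wellFounded <-wf =
    Subrelation.wellFounded (λ { (inj₁ lt) → inj₁ lt ; (inj₂ (eq , p)) → inj₂ (sym eq , eq , p) })
      (On.wellFounded (λ s → length s , s) (×-wellFounded ℕ.<-wellFounded λ s → lex-acc _ s refl))
    where
    _⊏_ : Rel (List B) 0ℓ
    t ⊏ s = length s ≡ length t × Lex-< _≡_ _<_ t s

    lex-acc : ∀ n s → length s ≡ n → Acc _⊏_ s
    lex-acc _       []      _    = acc λ { (_ , base ()) }
    lex-acc (suc n) (a ∷ s) eq = acc-∷′ (<-wf a) s (ℕₚ.suc-injective eq)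
      where
      acc-∷ : ∀ {b} → (∀ {c} → c < b → ∀ u → length u ≡ n → Acc _⊏_ (c ∷ u)) →
              ∀ {t} → length t ≡ n → Acc _⊏_ t → Acc _⊏_ (b ∷ t)
      acc-∷ {b} acc-smaller {t} len-t (acc rt) = acc below
        where
        below : ∀ {u} → u ⊏ (b ∷ t) → Acc _⊏_ u
        below {c ∷ u} (eq , lt) with trans (sym (ℕₚ.suc-injective eq)) len-t
        below {c ∷ u} (eq , this c<b)    | len-u = acc-smaller c<b u len-u
        below {c ∷ u} (eq , next refl p) | len-u = acc-∷ acc-smaller len-u (rt (ℕₚ.suc-injective eq , p))

      acc-∷′ : ∀ {b} → Acc _<_ b → ∀ t → length t ≡ n → Acc _⊏_ (b ∷ t)
      acc-∷′ (acc rb) t len-t = acc-∷ (λ c<b → acc-∷′ (rb c<b)) len-t (lex-acc n t len-t)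

-- Clauses up to permutation and flipping

private
  module ≅ {T : Set} = IsEquivalence (≅-isEquivalence {T})
  module ≋ {T : Set} where
    open Setoid (clauseSetoid T) public using (refl; sym; trans; reflexive)
    open Permutation (literalSetoid T) public using (↭-prep; ↭-swap)
    open Permutationₚ (literalSetoid T) public
      using (Any-resp-↭; ∈-resp-↭; ¬x∷xs↭[]; xs↭ys⇒|xs|≡|ys|; drop-∷)

≋-singleton⁻ : ∀ {T} {C : Clause T} {L} → C ≋ L ∷ [] → ∃[ K ] C ≡ K ∷ [] × K ≅ L
≋-singleton⁻ {C = []} p = contradiction (≋.sym p) ≋.¬x∷xs↭[]
≋-singleton⁻ {C = K ∷ []} p with here K≅L ← ≋.∈-resp-↭ p (here ≅.refl) = K , refl , K≅L
≋-singleton⁻ {C = _ ∷ _ ∷ _} p with () ← ≋.xs↭ys⇒|xs|≡|ys| p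

negative-resp-≅ : ∀ {T} {K L : Literal T} → K ≅ L → Negative K → Negative L
negative-resp-≅ same negative = negative
negative-resp-≅ flip negative = negative

positive-resp-≅ : ∀ {T} {K L : Literal T} → K ≅ L → Positive K → Positive L
positive-resp-≅ same positive = positive
positive-resp-≅ flip positive = positive

≋-flip : ∀ {T p} {s t : T} {C} → literal p s t ∷ C ≋ literal p t s ∷ C
≋-flip = Permutation.prep flip ≋.refl

mapLiteral-≅ : ∀ {T U} (f : T → U) {K L} → K ≅ L → mapLiteral f K ≅ mapLiteral f L
mapLiteral-≅ f same = same
mapLiteral-≅ f flip = flip

mapClause-resp-≋ : ∀ {T U} (f : T → U) {C D : Clause T} → C ≋ D → mapClause f C ≋ mapClause f D
mapClause-resp-≋ f = Permutationₚ.map⁺ (literalSetoid _) (literalSetoid _) (mapLiteral-≅ f)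

∈ᶜ-resp-≋ : ∀ {T} {N} {C D : Clause T} → C ≋ D → C ∈ᶜ N → D ∈ᶜ N
∈ᶜ-resp-≋ = Membershipₚ.∈-resp-≈ (clauseSetoid _)

unselected : ∀ {T} {σ : Maybe (Literal T)} → σ ≡ nothing → ∀ C →
             ¬ Any (λ L → MaybeU.Any (L ≅_) σ) C
unselected refl C = (λ { (_ , ()) }) ∘ Any.satisfied

selected-just : ∀ {T} {σ : Maybe (Literal T)} {K L} → σ ≡ just L → K ≅ L → MaybeU.Any (K ≅_) σ
selected-just refl K≅L = MaybeU.just K≅L

++-[] : ∀ {T} (C : Clause T) → C ≋ C ++ []
++-[] C = ≋.reflexive (sym (++-identityʳ C))

-- `IsGClauseOf` matches literals position by position, whereas the rules find a literal up to
-- permutation. A literal and its ground counterpart are therefore moved to the front together.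
pointwise-extract : ∀ {T U} {_∼_ : Literal T → Literal U → Set} {G C} {P : Literal U → Set} →
  Pointwise _∼_ G C → Any P C →
  ∃[ K ] ∃[ L ] ∃[ F ] ∃[ D ] K ∼ L × P L × G ≋ K ∷ F × C ≋ L ∷ D × Pointwise _∼_ F D
pointwise-extract (K∼L ∷ F∼D) (here pL) = _ , _ , _ , _ , K∼L , pL , ≋.refl , ≋.refl , F∼D
pointwise-extract (K∼L ∷ F∼D) (there p)
  with _ , _ , _ , _ , K′∼L′ , pL , G≋ , C≋ , F∼D′ ← pointwise-extract F∼D p =
  _ , _ , _ , _ , K′∼L′ , pL , ≋.trans (≋.↭-prep _ G≋) (≋.↭-swap _ _ ≋.refl)
                , ≋.trans (≋.↭-prep _ C≋) (≋.↭-swap _ _ ≋.refl) , K∼L ∷ F∼D′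

-- Compares the two cut points of one word. A tie goes to the second case, so the overlap `a ∷ k` in
-- the first is nonempty, as Superposition demands.
++-overlap : ∀ {A : Set} (l : List A) {w} v {z} → l ++ w ≡ v ++ z →
             (∃[ a ] ∃[ k ] l ≡ v ++ a ∷ k × z ≡ a ∷ k ++ w) ⊎ (∃[ k ] v ≡ l ++ k × w ≡ k ++ z)
++-overlap []      v       eq = inj₂ (v , refl , eq)
++-overlap (b ∷ l) []      eq = inj₁ (b , l , refl , sym eq)
++-overlap (b ∷ l) (c ∷ v) eq with refl , eq′ ← ∷-injective eq with ++-overlap l v eq′
... | inj₁ (a , k , refl , q) = inj₁ (a , k , refl , q)
... | inj₂ (k , refl , q)     = inj₂ (k , refl , q)

-- Words over the alphabet

module Words (𝒜 : Alphabet) where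
  open Alphabet 𝒜
  open Calculus 𝒜
  private
    module < = IsStrictTotalOrder isStrictTotalOrder
    module G = Inferences _≻ˢ_ using (Selected)

  _≟ˢ_ : DecidableEquality Str
  _≟ˢ_ = ≡-dec <._≟_

  <-wellFounded : WellFounded _<_
  <-wellFounded = Subrelation.wellFounded transport (On.wellFounded to (spo-wellFounded isSPO))
    where
    open Inverse finite using (to; from; strictlyInverseʳ)
    isSPO : IsStrictPartialOrder _≡_ (λ i j → from i < from j)
    isSPO = record
      { isEquivalence = ≡.isEquivalence
      ; irrefl        = λ i≡j → <.irrefl (cong from i≡j)
      ; trans         = <.trans
      ; <-resp-≈      = resp₂ _
      }
    transport : ∀ {a b} → a < b → from (to a) < from (to b)
    transport {a} {b} a<b rewrite strictlyInverseʳ a | strictlyInverseʳ b = a<b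

  ≻-trans : Transitive _≻_
  ≻-trans = lengthLex-trans <.trans

  ≻-compare : ∀ s t → s ≻ t ⊎ s ≡ t ⊎ t ≻ s
  ≻-compare = lengthLex-compare <.compare

  ≻-irrefl : ∀ {s} → ¬ (s ≻ s)
  ≻-irrefl s≻s = wf⇒asym (lengthLex-wellFounded <-wellFounded) s≻s s≻s

  ≻⇒≢[] : ∀ {s t} → s ≻ t → s ≢ []
  ≻⇒≢[] (inj₁ ()) refl
  ≻⇒≢[] (inj₂ (_ , base ())) refl

  ∷-++-≻ : ∀ a u v → (a ∷ u ++ v) ≻ v
  ∷-++-≻ a u v = inj₁ (ℕ.s≤s (subst (length v ℕ.≤_) (sym (length-++ u)) (ℕₚ.m≤n+m _ (length u))))

  _≽_ : Rel Str 0ℓ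
  s ≽ t = s ≡ t ⊎ s ≻ t

  ++-≽ : ∀ u v → (u ++ v) ≽ v
  ++-≽ []      v = inj₁ refl
  ++-≽ (a ∷ u) v = inj₂ (∷-++-≻ a u v)

  ≽-≻-trans : ∀ {s t u} → s ≽ t → t ≻ u → s ≻ u
  ≽-≻-trans (inj₁ refl) t≻u = t≻u
  ≽-≻-trans (inj₂ s≻t)  t≻u = ≻-trans s≻t t≻u

  least : ∀ x xs → ∃[ m ] m ∈ x ∷ xs × All (λ y → ¬ (m ≻ y)) (x ∷ xs)
  least x [] = x , here refl , ≻-irrefl ∷ []
  least x (y ∷ ys) with m , m∈ , min ← least y ys with ≻-compare m x
  ... | inj₁ m≻x = x , here refl , ≻-irrefl ∷ All.map (λ m⊁z x≻z → m⊁z (≻-trans m≻x x≻z)) min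
  ... | inj₂ (inj₁ refl) = m , there m∈ , ≻-irrefl ∷ min
  ... | inj₂ (inj₂ x≻m) = m , there m∈ , (λ m≻x → ≻-irrefl (≻-trans m≻x x≻m)) ∷ min

  -- Words as g-terms

  underlying : GTerm → Str
  underlying ⊥ᵍ      = []
  underlying (a · p) = a ∷ underlying p

  underlying-⊥ : ∀ u → underlying (u ⊥) ≡ u
  underlying-⊥ []      = refl
  underlying-⊥ (a ∷ u) = cong (a ∷_) (underlying-⊥ u)

  string-++ : ∀ u v → string ((u ++ v) ⊥) ≡ map [_] u ++ string (v ⊥)
  string-++ []      v = refl
  string-++ (a ∷ u) v = cong ([ a ] ∷_) (string-++ u v)

  length-string : ∀ u → length (string (u ⊥)) ≡ suc (length u)
  length-string []      = refl
  length-string (a ∷ u) = cong suc (length-string u)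

  ⊥-mono : ∀ {u v} → u ≻ v → (u ⊥) ≻ᵗ (v ⊥)
  ⊥-mono {u} {v} (inj₁ lt) =
    inj₁ (subst₂ ℕ._<_ (sym (length-string v)) (sym (length-string u)) (ℕ.s≤s lt))
  ⊥-mono {u} {v} (inj₂ (eq , p)) =
    inj₂ (trans (length-string u) (trans (cong suc eq) (sym (length-string v))) , lex p)
    where
    lex : ∀ {u v} → Lex-< _≡_ _<_ u v → Lex-< _≡_ (_<₋_ _<_) (string (u ⊥)) (string (v ⊥))
    -- The word that ends first continues with `⊥₋`, which lies below every letter.
    lex halt          = this ⊥₋<[ _ ]
    lex (this a<b)    = this [ a<b ]
    lex (next refl p) = next refl (lex p)

  -- The ordering on g-clauses

  private
    terms    = setoid GTerm
    sides    = multiset terms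
    literals = multiset sides
    _≻ᵐ_ = MultisetExt terms _≻ᵗ_
    _≻ˡ_ = MultisetExt sides _≻ᵐ_
    module Terms    = Permutation terms
    module Sides    = Permutation sides
    module Literals = Permutation literals

  -- One multiset extension for each layer: terms in a side, sides in a literal, literals in a
  -- clause.
  ≻ᵍ-wellFounded : WellFounded (converse _≻ᵍ_)
  ≻ᵍ-wellFounded = On.wellFounded (map literalMultiset)
    (multisetExt-wellFounded literals _≻ˡ_ (multisetExt-respˡ sides _≻ᵐ_)
      (multisetExt-wellFounded sides _≻ᵐ_ (multisetExt-respˡ terms _≻ᵗ_)
        (multisetExt-wellFounded terms _≻ᵗ_ (λ { refl → id })
          (On.wellFounded string (lengthLex-wellFounded (<₋-wellFounded _<_ <-wellFounded))))))

  ≻ᵍ-asym : Asymmetric _≻ᵍ_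
  ≻ᵍ-asym p q = wf⇒asym ≻ᵍ-wellFounded q p

  ≻ᵍ-irrefl : ∀ {G} → ¬ (G ≻ᵍ G)
  ≻ᵍ-irrefl p = ≻ᵍ-asym p p

  ≈-flip-≻ᵍ : ∀ {p q F} → ((p ≈ q) ∷ []) ≻ᵍ F → ((q ≈ p) ∷ []) ≻ᵍ F
  ≈-flip-≻ᵍ = multisetExt-respˡ literals _≻ˡ_
    (Permutation.prep (Sides.↭-swap _ _ Sides.↭-refl) Literals.↭-refl)

  private
    singleton-≻ᵐ : ∀ {x y} → x ≻ y → ((x ⊥) ∷ []) ≻ᵐ ((y ⊥) ∷ [])
    singleton-≻ᵐ x≻y = multisetExt-all terms _≻ᵗ_ (λ ()) (here (⊥-mono x≻y) ∷ [])

    pair-≻ᵐ : ∀ x v {y} → x ≽ y → ((x ⊥) ∷ (v ⊥) ∷ []) ≻ᵐ ((y ⊥) ∷ [])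
    pair-≻ᵐ x v (inj₁ refl) =
      -- Dropping `v` and putting nothing in its place is already a strict decrease.
      (v ⊥) ∷ [] , [] , (x ⊥) ∷ [] , (λ ()) , Terms.↭-swap _ _ Terms.↭-refl , Terms.↭-refl , []
    pair-≻ᵐ _ _ (inj₂ x≻y)  = multisetExt-all terms _≻ᵗ_ (λ ()) (here (⊥-mono x≻y) ∷ [])

    clause-≻ᵍ : ∀ G L → Any (λ K → literalMultiset K ≻ˡ literalMultiset L) G → G ≻ᵍ (L ∷ [])
    clause-≻ᵍ []      _ ()
    clause-≻ᵍ (_ ∷ _) _ K≻L = multisetExt-all literals _≻ˡ_ (λ ()) (Any.map⁺ K≻L ∷ [])

  unit-≻ᵍˡ : ∀ {x y x′ y′} → x ≻ x′ → x ≻ y′ → ((x ⊥ ≈ y ⊥) ∷ []) ≻ᵍ ((x′ ⊥ ≈ y′ ⊥) ∷ [])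
  unit-≻ᵍˡ {x} {y} x≻x′ x≻y′ = clause-≻ᵍ ((x ⊥ ≈ y ⊥) ∷ []) (_ ≈ _)
    (here (multisetExt-all sides _≻ᵐ_ (λ ()) (here (singleton-≻ᵐ x≻x′) ∷ here (singleton-≻ᵐ x≻y′) ∷ [])))

  unit-≻ᵍʳ : ∀ {x y y′} → y ≻ y′ → ((x ⊥ ≈ y ⊥) ∷ []) ≻ᵍ ((x ⊥ ≈ y′ ⊥) ∷ [])
  unit-≻ᵍʳ {x} {y} {y′} y≻y′ = clause-≻ᵍ ((x ⊥ ≈ y ⊥) ∷ []) (x ⊥ ≈ y′ ⊥) (here
    ( ((y ⊥) ∷ []) ∷ [] , ((y′ ⊥) ∷ []) ∷ [] , ((x ⊥) ∷ []) ∷ [] , (λ ())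
    , Sides.↭-swap _ _ Sides.↭-refl , Sides.↭-swap _ _ Sides.↭-refl , here (singleton-≻ᵐ y≻y′) ∷ []))

  -- A negative literal keeps both terms in one side, so it exceeds an equation whose larger term is
  -- `x` itself. Hence a clause stays the maximal premise even when its condition is rewritten at
  -- the root.
  negative-≻ᵍ : ∀ {G x v y z} → Any (_≅ (x ⊥ ≉ v ⊥)) G → x ≽ y → x ≻ z → G ≻ᵍ ((y ⊥ ≈ z ⊥) ∷ [])
  negative-≻ᵍ {x = x} {v} {y} {z} x≉v∈G x≽y x≻z = clause-≻ᵍ _ (y ⊥ ≈ z ⊥) (Any.map
    (λ { same → bigger
       ; flip → multisetExt-respˡ sides _≻ᵐ_
                  (Permutation.prep (Terms.↭-swap _ _ Terms.↭-refl) Sides.↭-refl) bigger }) x≉v∈G)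
    where
    bigger : literalMultiset (x ⊥ ≉ v ⊥) ≻ˡ literalMultiset (y ⊥ ≈ z ⊥)
    bigger = multisetExt-all sides _≻ᵐ_ (λ ())
      (here (pair-≻ᵐ x v x≽y) ∷ here (pair-≻ᵐ x v (inj₂ x≻z)) ∷ [])

  -- Inferences between g-clauses

  string≢[] : ∀ p → string p ≢ []
  string≢[] ⊥ᵍ      ()
  string≢[] (a · p) ()

  -- Every g-term ends in `⊥`, so overlapping left sides end together: `u₃` is empty, and `u₂` is
  -- nonempty because it contains `⊥`.
  superpositionᵍ : ∀ v {x y z σ τ} → σ ≡ nothing → τ ≡ nothing → (v ++ x) ≻ y → x ≻ z →
    InferG Superposition
      ((mapClause string (((v ++ x) ⊥ ≈ y ⊥) ∷ []) , σ) ∷ (mapClause string ((x ⊥ ≈ z ⊥) ∷ []) , τ) ∷ [])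
      (mapClause string (((v ++ z) ⊥ ≈ y ⊥) ∷ []))
  superpositionᵍ v {x} {y} {z} σ≡ τ≡ vx≻y x≻z =
    InferG.superposition {C = []} {D = []} {u₁ = map [_] v} {u₂ = string (x ⊥)} {u₃ = []}
      (≋.reflexive (cong (λ e → (e ≈ string (y ⊥)) ∷ []) (string-++ v x)))
      (≋.reflexive (cong (λ e → (e ≈ string (z ⊥)) ∷ []) (sym (++-identityʳ _))))
      (≋.reflexive (cong₂ (λ e f → (e ≈ f) ∷ []) (string-++ v z) (sym (++-identityʳ _))))
      (string≢[] (x ⊥)) (unselected σ≡ _) (unselected τ≡ _)
      (subst (_≻ˢ string (y ⊥)) (string-++ v x) (⊥-mono vx≻y))
      (subst (_≻ˢ string (z ⊥)) (sym (++-identityʳ _)) (⊥-mono x≻z))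

  rewritingᵍ : ∀ ⋈ v {x y z σ τ G K} → G ≋ literal ⋈ ((v ++ x) ⊥) (y ⊥) ∷ K →
    (⋈ ≡ negative → G.Selected σ (literal ⋈ (string ((v ++ x) ⊥)) (string (y ⊥)))) →
    (⋈ ≡ positive → σ ≡ nothing) → τ ≡ nothing → x ≻ z →
    InferG Rewrite
      ((mapClause string G , σ) ∷ (mapClause string ((x ⊥ ≈ z ⊥) ∷ []) , τ) ∷ [])
      (mapClause string (literal ⋈ ((v ++ z) ⊥) (y ⊥) ∷ K))
  rewritingᵍ ⋈ v {x} {y} {z} {σ} {τ} {G} {K} G≋ selected unsel τ≡ x≻z =
    InferG.rewriting {C = mapClause string K} {D = []}
      {u₁ = map [_] v} {u₂ = string (x ⊥)} {u₃ = []} {s = string (y ⊥)} ⋈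
      (≋.trans (mapClause-resp-≋ string G≋) (≋.reflexive (cong (_∷ mapClause string K) (lit x))))
      ≋.refl
      (≋.trans (≋.reflexive (cong (_∷ mapClause string K) (lit z))) (++-[] _))
      (subst (G.Selected σ) (lit x) ∘ selected) (λ eq → unselected (unsel eq) _) (unselected τ≡ _)
      (⊥-mono x≻z)
    where
    lit : ∀ u → literal ⋈ (string ((v ++ u) ⊥)) (string (y ⊥)) ≡
                literal ⋈ (map [_] v ++ string (u ⊥) ++ []) (string (y ⊥))
    lit u = cong (λ e → literal ⋈ e (string (y ⊥)))
      (trans (string-++ v u) (cong (map [_] v ++_) (sym (++-identityʳ _))))

  -- Taking equations as arguments lets rebracketed words match the constructor `positive`.
  gLiteral : ∀ {x y s t} w → x ≡ s ++ w → y ≡ t ++ w → IsGLiteralOf (x ⊥ ≈ y ⊥) (s ≈ t)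
  gLiteral w refl refl = positive w

  holds-resp-≅ : ∀ I {K L} → K ≅ L → Holds I K → Holds I L
  holds-resp-≅ I same h = h
  holds-resp-≅ I flip (positive p~q) = positive (IsEquivalence.sym (Interpretation.isEquivalence I) p~q)
  holds-resp-≅ I flip (negative p≁q) = negative (p≁q ∘ IsEquivalence.sym (Interpretation.isEquivalence I))

  satisfiesG-resp-≋ : ∀ I {G H} → G ≋ H → SatisfiesG I G → SatisfiesG I H
  satisfiesG-resp-≋ I = ≋.Any-resp-↭ (holds-resp-≅ I)

  -- Decidable equality of clauses and enumeration of words

  _≅?_ : Decidable (_≅_ {Str})
  literal p s t ≅? literal q u v with p ≟ᵖ q
    where
    _≟ᵖ_ : DecidableEquality Polarity
    positive ≟ᵖ positive = yes refl
    positive ≟ᵖ negative = no λ ()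
    negative ≟ᵖ positive = no λ ()
    negative ≟ᵖ negative = yes refl
  ... | no p≢q = no λ { same → p≢q refl ; flip → p≢q refl }
  ... | yes refl = map′ (λ { (inj₁ (refl , refl)) → same ; (inj₂ (refl , refl)) → flip })
                        (λ { same → inj₁ (refl , refl) ; flip → inj₂ (refl , refl) })
                        ((s ≟ˢ u ×-dec t ≟ˢ v) ⊎-dec (s ≟ˢ v ×-dec t ≟ˢ u))

  _≋?_ : Decidable (_≋_ {Str})
  []      ≋? []      = yes ≋.refl
  []      ≋? (_ ∷ _) = no (≋.¬x∷xs↭[] ∘ ≋.sym)
  (L ∷ C) ≋? D with Any.any? (L ≅?_) D
  ... | no L∉D  = no λ p → L∉D (≋.∈-resp-↭ p (here ≅.refl))
  ... | yes L∈D with D′ , p ← ∈⇒↭∷ (literalSetoid Str) L∈D =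
    map′ (λ q → ≋.trans (≋.↭-prep L q) (≋.sym p)) (λ q → ≋.drop-∷ (≋.trans q p)) (C ≋? D′)

  _∈ᶜ?_ : Decidable (_∈ᶜ_ {Str})
  C ∈ᶜ? N = Any.any? (C ≋?_) N

  letters : List Letter
  letters = map (Inverse.from finite) (allFin size)

  ∈-letters : ∀ a → a ∈ letters
  ∈-letters a = subst (_∈ letters) (Inverse.strictlyInverseʳ finite a)
    (∈.∈-map⁺ _ (∈.∈-allFin (Inverse.to finite a)))

  wordsUpTo : ℕ → List Str
  wordsUpTo zero    = [] ∷ []
  wordsUpTo (suc n) = [] ∷ cartesianProductWith _∷_ letters (wordsUpTo n)

  ∈-wordsUpTo : ∀ {n u} → length u ℕ.≤ n → u ∈ wordsUpTo n
  ∈-wordsUpTo {zero}  {[]}    _           = here refl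
  ∈-wordsUpTo {suc n} {[]}    _           = here refl
  ∈-wordsUpTo {suc n} {a ∷ u} (ℕ.s≤s u≤n) =
    there (∈.∈-cartesianProductWith⁺ _∷_ (∈-letters a) (∈-wordsUpTo u≤n))

-- Oriented unit equations of a conditional theory

module Theory
  (𝒜 : Alphabet) (selection : Calculus.SelectionFunction 𝒜)
  (R : List (Clause (Calculus.Str 𝒜))) (R-conditional : All IsConditionalEquation R) where
  open Alphabet 𝒜
  open Calculus 𝒜
  open WithSelection selection
  open SelectionFunction selection
  open Words 𝒜
  open IsStrictTotalOrder isStrictTotalOrder using (_≟_)

  ∈R⇒conditional : ∀ {C} → C ∈ᶜ R → IsConditionalEquation C
  ∈R⇒conditional C∈R = go R-conditional C∈R
    where
    go : ∀ {N C} → All IsConditionalEquation N → C ∈ᶜ N → IsConditionalEquation C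
    go ((cs , l , r , p) ∷ _) (here q) = cs , l , r , ≋.trans q p
    go (_ ∷ ps) (there C∈) = go ps C∈

  ¬negative⇒unit : ∀ {C : Clause Str} → IsConditionalEquation C → ¬ Any Negative C →
                   ∃[ l ] ∃[ r ] C ≡ (l ≈ r) ∷ []
  ¬negative⇒unit ([] , l , r , p) _ with ≋-singleton⁻ p
  ... | _ , refl , same = _ , _ , refl
  ... | _ , refl , flip = _ , _ , refl
  ¬negative⇒unit (_ ∷ _ , l , r , p) ¬neg =
    contradiction (≋.Any-resp-↭ negative-resp-≅ (≋.sym p) (there (here negative))) ¬neg

  positive∈R : ∀ {C} → C ∈ᶜ R → Any Positive C
  positive∈R C∈R with _ , _ , _ , p ← ∈R⇒conditional C∈R =
    ≋.Any-resp-↭ positive-resp-≅ (≋.sym p) (here positive)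

  select-unit : ∀ l r → select ((l ≈ r) ∷ []) ≡ nothing
  select-unit l r with select ((l ≈ r) ∷ []) in eq
  ... | nothing = refl
  ... | just L with sound eq
  ...   | negative , here ()

  record UnitRule (l r : Str) : Set where
    constructor unitRule
    field
      oriented : l ≻ r
      unit∈R   : ((l ≈ r) ∷ []) ∈ᶜ R

  unitRules : Clause Str → List (Str × Str)
  unitRules ((l ≈ r) ∷ []) with ≻-compare l r
  ... | inj₁ _        = (l , r) ∷ []
  ... | inj₂ (inj₁ _) = []
  ... | inj₂ (inj₂ _) = (r , l) ∷ []
  unitRules _ = []

  rules : List (Str × Str)
  rules = concatMap unitRules R

  unitRules-sound : ∀ {l r} C → (l , r) ∈ unitRules C → l ≻ r × C ≋ (l ≈ r) ∷ []
  unitRules-sound ((l ≈ r) ∷ []) l,r∈ with ≻-compare l r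
  unitRules-sound ((l ≈ r) ∷ []) (here refl) | inj₁ l≻r = l≻r , ≋.refl
  unitRules-sound ((l ≈ r) ∷ []) ()          | inj₂ (inj₁ _)
  unitRules-sound ((l ≈ r) ∷ []) (here refl) | inj₂ (inj₂ r≻l) = r≻l , ≋-flip

  unitRules-complete : ∀ {l r} C → l ≻ r → C ≋ (l ≈ r) ∷ [] → (l , r) ∈ unitRules C
  unitRules-complete C l≻r p with ≋-singleton⁻ p
  unitRules-complete {l} {r} _ l≻r p | _ , refl , same with ≻-compare l r
  ... | inj₁ _           = here refl
  ... | inj₂ (inj₁ refl) = contradiction l≻r ≻-irrefl
  ... | inj₂ (inj₂ r≻l)  = contradiction (≻-trans l≻r r≻l) ≻-irrefl
  unitRules-complete {l} {r} _ l≻r p | _ , refl , flip with ≻-compare r l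
  ... | inj₁ r≻l         = contradiction (≻-trans l≻r r≻l) ≻-irrefl
  ... | inj₂ (inj₁ refl) = contradiction l≻r ≻-irrefl
  ... | inj₂ (inj₂ _)    = here refl

  rules-sound : ∀ {l r} → (l , r) ∈ rules → UnitRule l r
  rules-sound l,r∈ with C , C∈R , l,r∈C ← find (∈.∈-concatMap⁻ unitRules {xs = R} l,r∈)
                   with l≻r , p ← unitRules-sound C l,r∈C =
    unitRule l≻r (Any.map (λ { refl → ≋.sym p }) C∈R)

  rules-complete : ∀ {l r} → UnitRule l r → (l , r) ∈ rules
  rules-complete (unitRule l≻r l≈r∈R) =
    ∈.∈-concatMap⁺ unitRules (Any.map (λ p → unitRules-complete _ l≻r (≋.sym p)) l≈r∈R)

  -- Rewriting with the unit equations of R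

  infix 4 _▷_ _↦_ _⟶_

  -- Letters are unary function symbols, so contraction at the root acts on a prefix, and `w` is the
  -- argument substituted into the rule.
  data _▷_ : Rel Str 0ℓ where
    contract : ∀ {l r x} → UnitRule l r → ∀ w → x ≡ l ++ w → x ▷ (r ++ w)

  data _↦_ : Rel Str 0ℓ where
    root  : ∀ {x y} → x ▷ y → x ↦ y
    under : ∀ a {x y} → x ↦ y → (a ∷ x) ↦ (a ∷ y)

  -- The argument of a root redex must be irreducible for all of `_↦_`, not only for `_⟶_`. The
  -- source may be written `a ∷ x` because left sides of rules are nonempty.
  data _⟶_ : Rel Str 0ℓ where
    root  : ∀ {a x y} → IsNormalForm _↦_ x →
            (a ∷ x) ▷ y → (∀ {z} → (a ∷ x) ▷ z → ¬ (y ≻ z)) → (a ∷ x) ⟶ y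
    under : ∀ a {x y} → x ⟶ y → (a ∷ x) ⟶ (a ∷ y)

  -- Computing contracta and successors

  prefix? : ∀ (l x : Str) → Dec (∃[ w ] l ++ w ≡ x)
  prefix? []      x       = yes (x , refl)
  prefix? (_ ∷ _) []      = no λ ()
  prefix? (a ∷ l) (b ∷ x) with a ≟ b | prefix? l x
  ... | no a≢b   | _               = no λ (_ , eq) → a≢b (proj₁ (∷-injective eq))
  ... | yes _    | no ¬p           = no λ (w , eq) → ¬p (w , proj₂ (∷-injective eq))
  ... | yes refl | yes (w , refl)  = yes (w , refl)

  contractaBy : Str → Str × Str → List Str
  contractaBy x (l , r) with prefix? l x
  ... | yes (w , _) = (r ++ w) ∷ []
  ... | no _        = []

  contracta : Str → List Str
  contracta x = concatMap (contractaBy x) rules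

  contracta-sound : ∀ {x y} → y ∈ contracta x → x ▷ y
  contracta-sound {x} y∈
    with (l , r) , l,r∈ , y∈′ ← find (∈.∈-concatMap⁻ (contractaBy x) {xs = rules} y∈)
    with prefix? l x | y∈′
  ... | yes (w , refl) | here refl = contract (rules-sound l,r∈) w refl
  ... | no _           | ()

  contracta-complete : ∀ {x y} → x ▷ y → y ∈ contracta x
  contracta-complete (contract {l} {r} ρ w refl) =
    ∈.∈-concatMap⁺ (contractaBy (l ++ w)) (lose (rules-complete ρ) found)
    where
    found : r ++ w ∈ contractaBy (l ++ w) (l , r)
    found with prefix? l (l ++ w)
    ... | yes (w′ , eq) = here (cong (r ++_) (sym (++-cancelˡ l w′ w eq)))
    ... | no ¬p         = contradiction (w , refl) ¬p

  successors : Str → List Str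
  successors []      = contracta []
  successors (a ∷ x) = contracta (a ∷ x) ++ map (a ∷_) (successors x)

  successors-sound : ∀ {x y} → y ∈ successors x → x ↦ y
  successors-sound {[]}    y∈ = root (contracta-sound y∈)
  successors-sound {a ∷ x} y∈ with ∈.∈-++⁻ (contracta (a ∷ x)) y∈
  ... | inj₁ y∈′ = root (contracta-sound y∈′)
  ... | inj₂ y∈′ with _ , z∈ , refl ← ∈.∈-map⁻ (a ∷_) y∈′ = under a (successors-sound z∈)

  successors-complete : ∀ {x y} → x ↦ y → y ∈ successors x
  successors-complete {[]}    (root c)    = contracta-complete c
  successors-complete {a ∷ x} (root c)    = ∈.∈-++⁺ˡ (contracta-complete c)
  successors-complete {a ∷ x} (under a s) =
    ∈.∈-++⁺ʳ (contracta (a ∷ x)) (∈.∈-map⁺ (a ∷_) (successors-complete s))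

  -- Orientation, determinism and progress

  ▷⇒≻ : ∀ {x y} → x ▷ y → x ≻ y
  ▷⇒≻ (contract (unitRule l≻r _) w refl) = lengthLex-++ʳ w l≻r

  ↦⇒≻ : ∀ {x y} → x ↦ y → x ≻ y
  ↦⇒≻ (root c)    = ▷⇒≻ c
  ↦⇒≻ (under a s) = lengthLex-++ˡ (a ∷ []) (↦⇒≻ s)

  ⟶⇒↦ : _⟶_ ⇒ _↦_
  ⟶⇒↦ (root _ c _) = root c
  ⟶⇒↦ (under a s)  = under a (⟶⇒↦ s)

  ⟶-deterministic : Deterministic _≡_ _⟶_
  ⟶-deterministic (root _ c min) (root _ c′ min′) with ≻-compare _ _
  ... | inj₁ y≻y′        = contradiction y≻y′ (min c′)
  ... | inj₂ (inj₁ y≡y′) = y≡y′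
  ... | inj₂ (inj₂ y′≻y) = contradiction y′≻y (min′ c)
  ⟶-deterministic (root nf _ _) (under _ s)  = contradiction (_ , ⟶⇒↦ s) nf
  ⟶-deterministic (under _ s)  (root nf _ _) = contradiction (_ , ⟶⇒↦ s) nf
  ⟶-deterministic (under a s)  (under a s′)  = cong (a ∷_) (⟶-deterministic s s′)

  -- The restriction to `_⟶_` adds no normal forms: the shortest reducible suffix has an irreducible
  -- argument, and its finitely many contracta include a least one.
  progress : ∀ x → IsNormalForm _↦_ x ⊎ ∃ (x ⟶_)
  progress [] = inj₁ λ { (_ , root c) → ≻⇒≢[] (▷⇒≻ c) refl }
  progress (a ∷ x) with progress x
  ... | inj₂ (y , s) = inj₂ (a ∷ y , under a s)
  ... | inj₁ nf with contracta (a ∷ x) in eq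
  ...   | [] = inj₁ λ { (_ , root c) → case subst (_ ∈_) eq (contracta-complete c) of λ ()
                      ; (_ , under _ s) → nf (_ , s) }
  ...   | y ∷ ys with z , z∈ , min ← least y ys =
    inj₂ (z , root nf (contracta-sound (subst (z ∈_) (sym eq) z∈))
                      (λ c → All.lookup min (subst (_ ∈_) eq (contracta-complete c))))

  -- The congruence generated by the deterministic steps

  infix 4 _≃_
  _≃_ : Rel Str 0ℓ
  _≃_ = EqClosure _⟶_

  ≃-sym : ∀ {x y} → x ≃ y → y ≃ x
  ≃-sym = EqClosure.symmetric _⟶_

  ⟶⇒≃ : _⟶_ ⇒ _≃_
  ⟶⇒≃ s = fwd s ◅ ε

  ≃-++ˡ : ∀ u {x y} → x ≃ y → (u ++ x) ≃ (u ++ y)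
  ≃-++ˡ []      e = e
  ≃-++ˡ (a ∷ u) e = EqClosure.gmap (a ∷_) (under a) (≃-++ˡ u e)

  ≃-normal : ∀ {x y} → IsNormalForm _↦_ x → IsNormalForm _↦_ y → x ≃ y → x ≡ y
  ≃-normal nfx nfy = conf⇒unf (det⇒conf ⟶-deterministic)
    (λ (_ , s) → nfx (_ , ⟶⇒↦ s)) (λ (_ , s) → nfy (_ , ⟶⇒↦ s))

  model : Interpretation
  model = record
    { _~_           = λ p q → underlying p ≃ underlying q
    ; isEquivalence = On.isEquivalence underlying (EqClosure.isEquivalence _⟶_)
    ; ·-cong        = λ a → ≃-++ˡ (a ∷ [])
    }

  -- The contracted instance is again a step, which the overlap argument needs. Leastness is kept
  -- only for an empty context, the one case in which it is needed to compare two instances.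
  redex : ∀ {x y} → x ⟶ y → ∃[ v ] ∃[ l ] ∃[ r ] ∃[ w ]
    x ≡ v ++ l ++ w × y ≡ v ++ r ++ w × UnitRule l r × (l ++ w) ⟶ (r ++ w) ×
    (v ≡ [] → ∀ {z} → x ▷ z → ¬ (y ≻ z))
  redex s@(root _ (contract {l} {r} ρ w eq) min) =
    [] , l , r , w , eq , refl , ρ , subst (_⟶ (r ++ w)) eq s , λ _ → min
  redex (under a s) with v , l , r , w , refl , refl , ρ , t , _ ← redex s =
    a ∷ v , l , r , w , refl , refl , ρ , t , λ ()

  holds⁺ : ∀ {x y} → x ≃ y → Holds model (x ⊥ ≈ y ⊥)
  holds⁺ {x} {y} x≃y = positive (subst₂ _≃_ (sym (underlying-⊥ x)) (sym (underlying-⊥ y)) x≃y)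

  holds⁻ : ∀ {x y} → Holds model (x ⊥ ≈ y ⊥) → x ≃ y
  holds⁻ {x} {y} (positive x~y) = subst₂ _≃_ (underlying-⊥ x) (underlying-⊥ y) x~y

  satisfied⁻ : ∀ {x y} → SatisfiesG model ((x ⊥ ≈ y ⊥) ∷ []) → x ≃ y
  satisfied⁻ (here h) = holds⁻ h

  refutes⁺ : ∀ {x y} → ¬ (x ≃ y) → Holds model (x ⊥ ≉ y ⊥)
  refutes⁺ {x} {y} x≄y = negative (x≄y ∘ subst₂ _≃_ (underlying-⊥ x) (underlying-⊥ y))

  refutes⁻ : ∀ {x y} → Holds model (x ⊥ ≉ y ⊥) → ¬ (x ≃ y)
  refutes⁻ {x} {y} (negative x≁y) = x≁y ∘ subst₂ _≃_ (sym (underlying-⊥ x)) (sym (underlying-⊥ y))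

  -- The model of a saturated R

  module _ (saturated : Saturated (_∈ᶜ R)) where

    -- The induction hypothesis for well-founded induction on `_≻ᵍ_`.
    TrueBelow : Clause GTerm → Set
    TrueBelow G = ∀ {F C} → G ≻ᵍ F → C ∈ᶜ R → IsGClauseOf F C → SatisfiesG model F

    -- Redundancy supplies g-clauses of `R` below the maximal premise that entail `H`; by the
    -- induction hypothesis the model satisfies them, hence also `H`.
    conclusion-true : ∀ {rule Cs D Gs H G} → All (_∈ᶜ R) Cs → Infer rule (map premise Cs) D →
                      IsGInstance Cs D Gs H → IsMaximalIn G Gs → TrueBelow G → SatisfiesG model H
    conclusion-true Cs⊆R inference instanceᵍ maximal below
      with Fs , instances , Fs⊨H , smaller ← saturated Cs⊆R inference instanceᵍ maximal =
      Fs⊨H model (All.zipWith (λ ((_ , C∈R , F∈C) , G≻F) → below G≻F C∈R F∈C) (instances , smaller))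

    maximal₁ : ∀ {G} → IsMaximalIn G (G ∷ [])
    maximal₁ = here refl , ≻ᵍ-irrefl ∷ []

    maximal₂ : ∀ {G F} → G ≻ᵍ F → IsMaximalIn G (G ∷ F ∷ [])
    maximal₂ G≻F = here refl , ≻ᵍ-irrefl ∷ ≻ᵍ-asym G≻F ∷ []

    -- The two bracketings of x spare the callers a transport of TrueBelow.

    superposition-true : ∀ v {a k u r r′ w x} → UnitRule (v ++ a ∷ k) r → UnitRule (a ∷ k ++ u) r′ →
      x ≡ v ++ (a ∷ k ++ u) ++ w → x ≡ (v ++ a ∷ k) ++ u ++ w →
      let G = (x ⊥ ≈ (r ++ u ++ w) ⊥) ∷ [] in
      G ≻ᵍ ((((a ∷ k ++ u) ++ w) ⊥ ≈ (r′ ++ w) ⊥) ∷ []) → TrueBelow G →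
      (v ++ r′ ++ w) ≃ (r ++ u ++ w)
    superposition-true v {a} {k} {u} {r} {r′} {w}
      (unitRule l≻r l≈r∈R) (unitRule l′≻r′ l′≈r′∈R) refl eq G≻F below =
      satisfied⁻ {y = r ++ u ++ w} (conclusion-true (l≈r∈R ∷ l′≈r′∈R ∷ [])
        (superposition {C = []} {D = []} {u₁ = v} {u₂ = a ∷ k} {u₃ = u} ≋.refl ≋.refl ≋.refl (λ ())
           (unselected (select-unit _ _) _) (unselected (select-unit _ _) _) l≻r l′≻r′)
        (record
          -- The left rule is extended by `u ++ w` and the right one by `w`, so that both ground
          -- left sides end together.
          { premises   = (gLiteral (u ++ w) eq refl ∷ []) ∷ (positive w ∷ []) ∷ []
          ; conclusion = gLiteral w (sym (++-assoc v r′ w)) (sym (++-assoc r u w)) ∷ []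
          ; inference  = superpositionᵍ v (cong (Maybe.map _) (select-unit _ _))
                           (cong (Maybe.map _) (select-unit _ _))
                           (subst (_≻ (r ++ u ++ w)) (sym eq) (lengthLex-++ʳ (u ++ w) l≻r))
                           (lengthLex-++ʳ w l′≻r′)
          })
        (maximal₂ G≻F) below)

    rewriting-true : ∀ v {l′ r′ u r w x} → UnitRule (v ++ l′ ++ u) r → UnitRule l′ r′ →
      x ≡ v ++ l′ ++ u ++ w → x ≡ (v ++ l′ ++ u) ++ w →
      let G = (x ⊥ ≈ (r ++ w) ⊥) ∷ [] in
      G ≻ᵍ (((l′ ++ u ++ w) ⊥ ≈ (r′ ++ u ++ w) ⊥) ∷ []) → TrueBelow G →
      (v ++ r′ ++ u ++ w) ≃ (r ++ w)
    rewriting-true v {l′} {r′} {u} {r} {w}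
      (unitRule l≻r l≈r∈R) (unitRule l′≻r′ l′≈r′∈R) refl eq G≻F below =
      satisfied⁻ {y = r ++ w} (conclusion-true (l≈r∈R ∷ l′≈r′∈R ∷ [])
        (rewriting {C = []} {D = []} {u₁ = v} {u₂ = l′} {u₃ = u} positive ≋.refl ≋.refl ≋.refl (λ ())
           (λ _ → unselected (select-unit _ _) _) (unselected (select-unit _ _) _) l′≻r′)
        (record
          { premises   = (gLiteral w eq refl ∷ []) ∷ (gLiteral (u ++ w) refl refl ∷ []) ∷ []
          ; conclusion = gLiteral w (trans (cong (v ++_) (sym (++-assoc r′ u w)))
                                           (sym (++-assoc v (r′ ++ u) w))) refl ∷ []
          ; inference  = rewritingᵍ positive v {y = r ++ w} ≋.refl (λ ())
                           (λ _ → cong (Maybe.map _) (select-unit _ _))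
                           (cong (Maybe.map _) (select-unit _ _)) (lengthLex-++ʳ (u ++ w) l′≻r′)
          })
        (maximal₂ G≻F) below)

    -- Three relative positions of the redexes: past the end of `l` a smaller instance of the same
    -- rule suffices, sticking out of `l` calls for Superposition, and lying inside `l` calls for
    -- Rewrite.
    overlap-true : ∀ {l r l′ r′ w} v w′ → UnitRule l r → UnitRule l′ r′ → l ++ w ≡ v ++ l′ ++ w′ →
      let G = ((l ++ w) ⊥ ≈ (r ++ w) ⊥) ∷ [] in
      (l′ ++ w′) ⟶ (r′ ++ w′) → G ≻ᵍ (((l′ ++ w′) ⊥ ≈ (r′ ++ w′) ⊥) ∷ []) → TrueBelow G →
      (v ++ r′ ++ w′) ≃ (r ++ w)
    overlap-true {l} {r} {l′} {r′} v w′ ρ ρ′ eq s G≻F below with ++-overlap l v eq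
    -- l and l′ do not overlap: contracting l′ inside w gives a smaller instance of l ≈ r.
    ... | inj₂ (k , refl , refl) = begin
      (l ++ k) ++ r′ ++ w′ ≡⟨ ++-assoc l k (r′ ++ w′) ⟩
      l ++ k ++ r′ ++ w′   ≈⟨ smaller-instance ⟩
      r ++ k ++ r′ ++ w′   ≈⟨ ≃-++ˡ r (≃-++ˡ k (⟶⇒≃ s)) ⟨
      r ++ k ++ l′ ++ w′   ∎
      where
      open SetoidReasoning (EqClosure.setoid _⟶_)
      x≻x′  = lengthLex-++ˡ l (lengthLex-++ˡ k (↦⇒≻ (⟶⇒↦ s)))
      x′≻y′ = lengthLex-++ʳ (k ++ r′ ++ w′) (UnitRule.oriented ρ)
      smaller-instance : (l ++ k ++ r′ ++ w′) ≃ (r ++ k ++ r′ ++ w′)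
      smaller-instance = satisfied⁻ {y = r ++ k ++ r′ ++ w′}
        (below (unit-≻ᵍˡ {y = r ++ k ++ l′ ++ w′} x≻x′ (≻-trans x≻x′ x′≻y′)) (UnitRule.unit∈R ρ)
               (positive (k ++ r′ ++ w′) ∷ []))
    ... | inj₁ (a , k , refl , q) with ++-overlap l′ (a ∷ k) q
    ...   | inj₁ (b , u , refl , refl) = superposition-true v ρ ρ′ eq refl G≻F below
    ...   | inj₂ (u , p , refl) rewrite p = rewriting-true v ρ ρ′ eq refl G≻F below

    -- Below the root, `x` is a proper suffix of the larger side. At the root both equations have
    -- the same left side, and leastness leaves only `z` below `y` or `z` equal to `y`.
    dominates : ∀ v {x y z} → x ≻ z → (v ≡ [] → ¬ (z ≻ y)) →
                (((v ++ x) ⊥ ≈ y ⊥) ∷ []) ≻ᵍ ((x ⊥ ≈ z ⊥) ∷ []) ⊎ v ++ z ≡ y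
    dominates []      {x} {y} {z} x≻z z⊁y with ≻-compare y z
    ... | inj₁ y≻z         = inj₁ (unit-≻ᵍʳ {x} y≻z)
    ... | inj₂ (inj₁ y≡z)  = inj₂ (sym y≡z)
    ... | inj₂ (inj₂ z≻y)  = contradiction z≻y (z⊁y refl)
    dominates (a ∷ v) {y = y} x≻z _ =
      inj₁ (unit-≻ᵍˡ {y = y} (∷-++-≻ a v _) (≻-trans (∷-++-≻ a v _) x≻z))

    -- The chosen step from `l ++ w` either ends in `r ++ w` or uses a smaller equation, and then
    -- `overlap-true` connects its result with `r ++ w`.
    unit-true : ∀ {l r} → UnitRule l r → ∀ w →
                TrueBelow (((l ++ w) ⊥ ≈ (r ++ w) ⊥) ∷ []) → (l ++ w) ≃ (r ++ w)
    unit-true {l} {r} ρ w below with progress (l ++ w)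
    ... | inj₁ nf = contradiction (_ , root (contract ρ w refl)) nf
    ... | inj₂ (y , s) with v , l′ , r′ , w′ , eq , refl , ρ′ , s′ , min ← redex s
        with dominates v {y = r ++ w} (↦⇒≻ (⟶⇒↦ s′)) (λ { refl → min refl (contract ρ w refl) })
    ...   | inj₂ eq′ = subst ((l ++ w) ≃_) eq′ (⟶⇒≃ s)
    ...   | inj₁ G≻F = ⟶⇒≃ s ◅◅ overlap-true v w′ ρ ρ′ eq s′
      (subst (λ x → ((x ⊥ ≈ (r ++ w) ⊥) ∷ []) ≻ᵍ (((l′ ++ w′) ⊥ ≈ (r′ ++ w′) ⊥) ∷ [])) (sym eq) G≻F)
      below

    module _ {C G D F}
      (C∈R : C ∈ᶜ R) (G∈C : IsGClauseOf G C) (F∈D : IsGClauseOf F D) (below : TrueBelow G) where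

      -- The conclusion of the Rewrite inference is true. If its condition `x′ ≉ y` holds, so does
      -- `x ≉ y`, because `x ≃ x′`; otherwise a literal of `F` holds, and `F` is part of `G`.
      selected-rewriting-true : ∀ {x y x′ L} → C ≋ (x ≉ y) ∷ D → G ≋ (x ⊥ ≉ y ⊥) ∷ F →
        select C ≡ just L → (x ≉ y) ≅ L → x ⟶ x′ → SatisfiesG model G
      selected-rewriting-true {x} {y} {L = L} C≋ G≋ C↦L x≉y≅L s
        with v , l , r , w , refl , refl , unitRule l≻r l≈r∈R , s′ , _ ← redex s =
        satisfiesG-resp-≋ model (≋.sym G≋) (case H-true of λ
          { (here h)  → here (refutes⁺ {y = y} (refutes⁻ {y = y} h ∘ (≃-sym (⟶⇒≃ s) ◅◅_)))
          ; (there h) → there h })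
        where
        H-true : SatisfiesG model (((v ++ r ++ w) ⊥ ≉ y ⊥) ∷ F)
        H-true = conclusion-true (C∈R ∷ l≈r∈R ∷ [])
          (rewriting {C = D} {D = []} {u₁ = v} {u₂ = l} {u₃ = w} negative C≋ ≋.refl (++-[] _)
             (λ _ → selected-just C↦L x≉y≅L) (λ ())
             (unselected (select-unit _ _) _) l≻r)
          (record
            { premises   = G∈C ∷ (positive w ∷ []) ∷ []
            ; conclusion = negative ∷ F∈D
            ; inference  = rewritingᵍ negative v {y = y} G≋
                             (λ _ → selected-just (cong (Maybe.map _) C↦L) (mapLiteral-≅ _ x≉y≅L))
                             (λ ()) (cong (Maybe.map _) (select-unit _ _)) (lengthLex-++ʳ w l≻r)
            })
          (maximal₂ (negative-≻ᵍ {v = y}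
            (≋.Any-resp-↭ (λ p q → ≅.trans (≅.sym p) q) (≋.sym G≋) (here ≅.refl))
            (++-≽ v (l ++ w)) (≽-≻-trans (++-≽ v (l ++ w)) (lengthLex-++ʳ w l≻r)))) below

      selected-resolution-true : ∀ {x L} → C ≋ (x ≉ x) ∷ D → G ≋ (x ⊥ ≉ x ⊥) ∷ F →
        select C ≡ just L → (x ≉ x) ≅ L → SatisfiesG model G
      selected-resolution-true C≋ G≋ C↦L x≉x≅L =
        satisfiesG-resp-≋ model (≋.sym G≋) (there (conclusion-true (C∈R ∷ [])
          (equalityResolution C≋ (selected-just C↦L x≉x≅L))
          (record
            { premises   = G∈C ∷ []
            ; conclusion = F∈D
            ; inference  = InferG.equalityResolution (mapClause-resp-≋ string G≋)
                             (selected-just (cong (Maybe.map _) C↦L) (mapLiteral-≅ _ x≉x≅L))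
            })
          maximal₁ below))

    -- With nothing selected, the clause is a unit equation. Otherwise the selected condition has
    -- equal sides, a reducible side, or two distinct normal forms; in the last case it is true by
    -- uniqueness of normal forms.
    clause-true : ∀ {C G} → C ∈ᶜ R → IsGClauseOf G C → TrueBelow G → SatisfiesG model G
    clause-true {C} C∈R G∈C below with select C in C↦L
    ... | nothing
      with ¬negative⇒unit (∈R⇒conditional C∈R) (λ neg → case subst Is-just C↦L (total neg) of λ ())
    clause-true C∈R (positive w ∷ []) below | nothing | l , r , refl with ≻-compare l r
    ... | inj₁ l≻r         = here (holds⁺ (unit-true (unitRule l≻r C∈R) w below))
    ... | inj₂ (inj₁ refl) = here (holds⁺ {l ++ w} ε)
    ... | inj₂ (inj₂ r≻l)  = here (holds⁺ (≃-sym
      (unit-true (unitRule r≻l (∈ᶜ-resp-≋ ≋-flip C∈R)) w (λ G≻F → below (≈-flip-≻ᵍ G≻F)))))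
    clause-true C∈R G∈C below | just L with sound C↦L
    ... | L-negative , L∈C with pointwise-extract G∈C L∈C
    ... | K , M , F , D , K∈M , L≅M , G≋ , C≋ , F∈D with negative-resp-≅ L≅M L-negative | K∈M
    ... | negative {u} {v} | negative with u ≟ˢ v
    ... | yes refl = selected-resolution-true C∈R G∈C F∈D below C≋ G≋ C↦L (≅.sym L≅M)
    ... | no u≢v with progress u | progress v
    ... | inj₂ (_ , s) | _ = selected-rewriting-true C∈R G∈C F∈D below C≋ G≋ C↦L (≅.sym L≅M) s
    ... | inj₁ _ | inj₂ (_ , s) =
      selected-rewriting-true C∈R G∈C F∈D below (≋.trans C≋ ≋-flip)
        (≋.trans G≋ ≋-flip) C↦L (≅.trans flip (≅.sym L≅M)) s
    ... | inj₁ nfu | inj₁ nfv =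
      satisfiesG-resp-≋ model (≋.sym G≋) (here (refutes⁺ λ u≃v → u≢v (≃-normal nfu nfv u≃v)))

    model-satisfies : ∀ C → C ∈ᶜ R → Satisfies model C
    model-satisfies C C∈R G G∈C = go (≻ᵍ-wellFounded G) C∈R G∈C
      where
      go : ∀ {G C} → Acc (converse _≻ᵍ_) G → C ∈ᶜ R → IsGClauseOf G C → SatisfiesG model G
      go (acc smaller) C∈R G∈C = clause-true C∈R G∈C λ G≻F → go (smaller G≻F)

  -- Joinability and entailment

  _↦*_ : Rel Str 0ℓ
  _↦*_ = Star _↦_

  ↦-++ˡ : ∀ u {x y} → x ↦ y → (u ++ x) ↦ (u ++ y)
  ↦-++ˡ []      s = s
  ↦-++ˡ (a ∷ u) s = under a (↦-++ˡ u s)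

  ↦*⇒length≤ : ∀ {x y} → x ↦* y → length y ℕ.≤ length x
  ↦*⇒length≤ ε        = ℕₚ.≤-refl
  ↦*⇒length≤ (s ◅ ss) = ℕₚ.≤-trans (↦*⇒length≤ ss) (lengthLex⇒length≤ (↦⇒≻ s))

  module _ (I : Interpretation) (I⊨R : ∀ C → C ∈ᶜ R → Satisfies I C) where
    open Interpretation I
    private module ~ = IsEquivalence isEquivalence

    ↦-sound : ∀ {x y} → x ↦ y → ∀ w → ((x ++ w) ⊥) ~ ((y ++ w) ⊥)
    ↦-sound (root (contract {l} {r} ρ w′ refl)) w
      with I⊨R _ (UnitRule.unit∈R ρ) _ (gLiteral (w′ ++ w) (++-assoc l w′ w) (++-assoc r w′ w) ∷ [])
    ... | here (positive p~q) = p~q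
    ↦-sound (under a s) w = ·-cong a (↦-sound s w)

    ↦*-sound : ∀ {x y} → x ↦* y → ∀ w → ((x ++ w) ⊥) ~ ((y ++ w) ⊥)
    ↦*-sound ε        w = ~.refl
    ↦*-sound (s ◅ ss) w = ~.trans (↦-sound s w) (↦*-sound ss w)

  Joinable : Rel Str 0ℓ
  Joinable s t = ∃[ u ] s ↦* u × t ↦* u

  joinable⇒⊨ : ∀ {s t} → Joinable s t → (_∈ᶜ R) ⊨ ((s ≈ t) ∷ [])
  joinable⇒⊨ (u , s↦*u , t↦*u) I I⊨R _ (positive w ∷ []) =
    here (positive (~.trans (↦*-sound I I⊨R s↦*u w) (~.sym (↦*-sound I I⊨R t↦*u w))))
    where module ~ = IsEquivalence (Interpretation.isEquivalence I)

  -- Evaluating the instance with empty `w` in the model gives `s ≃ t`, and determinism turns a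
  -- conversion into a common reduct.
  ⊨⇒joinable : Saturated (_∈ᶜ R) → ∀ {s t} → (_∈ᶜ R) ⊨ ((s ≈ t) ∷ []) → Joinable s t
  ⊨⇒joinable saturated {s} {t} R⊨s≈t
    with here h ← R⊨s≈t model (model-satisfies saturated) _
                    (gLiteral [] (sym (++-identityʳ s)) (sym (++-identityʳ t)) ∷ []) =
    let u , p , q = church-rosser (holds⁻ h) in u , Star.map ⟶⇒↦ p , Star.map ⟶⇒↦ q
    where
    church-rosser : ∀ {x y} → x ≃ y → ∃[ z ] Star _⟶_ x z × Star _⟶_ y z
    church-rosser {x} ε = x , ε , ε
    church-rosser (fwd s ◅ e) with z , p , q ← church-rosser e = z , s ◅ p , q
    church-rosser (bwd s ◅ e) with z , p , q ← church-rosser e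
                              with w , p′ , q′ ← det⇒conf ⟶-deterministic (s ◅ ε) p = w , p′ , q ◅◅ q′

  -- Derivations from a goal

  module Search (s t : Str) where

    -- Each side of a goal is tracked to its origin in `s` or `t`; `≋` absorbs an exchange of sides.
    -- The empty clause carries the joinability that justifies it.
    data Derived (C : Clause Str) : Set where
      goal   : ∀ {u v} → C ≋ (u ≉ v) ∷ [] → s ↦* u → t ↦* v → Derived C
      solved : C ≋ [] → Joinable s t → Derived C

    -- The form every `Step` takes under the invariant. Rewriting only the left side is enough,
    -- since membership up to `≋` lets the goal be flipped first.
    data Consequence (N : List (Clause Str)) (D : Clause Str) : Set where
      resolve  : ∀ {u} → ((u ≉ u) ∷ []) ∈ᶜ N → D ≋ [] → Consequence N D
      rewrites : ∀ {u u′ v} → ((u ≉ v) ∷ []) ∈ᶜ N → u ↦ u′ → D ≋ (u′ ≉ v) ∷ [] → Consequence N D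

    record Invariant (N : List (Clause Str)) : Set where
      field
        axioms  : ∀ {C} → C ∈ᶜ R → C ∈ᶜ N
        initial : ((s ≉ t) ∷ []) ∈ᶜ N
        origin  : ∀ {C} → C ∈ᶜ N → C ∈ᶜ R ⊎ Derived C
    open Invariant

    invariant-start : Invariant (start R s t)
    invariant-start = record
      { axioms  = there
      ; initial = here ≋.refl
      ; origin  = λ { (here p) → inj₂ (goal p ε ε) ; (there C∈R) → inj₁ C∈R }
      }

    derived-¬positive : ∀ {C} → Derived C → ¬ Any Positive C
    derived-¬positive (goal p _ _) pos =
      case ≋.Any-resp-↭ positive-resp-≅ p pos of λ { (here ()) ; (there ()) }
    derived-¬positive (solved p _) pos = case ≋.Any-resp-↭ positive-resp-≅ p pos of λ ()

    -- A negative literal would force a selection; the selected literal is negative, so it is not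
    -- `L`, and by assumption it does not occur in `D`.
    unselected⇒¬negative : ∀ {C L D} → C ≋ L ∷ D → Positive L → NoneSelected (select C) D →
                           ¬ Any Negative C
    unselected⇒¬negative {C} C≋ L-positive D-unselected neg with select C in eq | total neg
    ... | just K | _ with K-negative , K∈C ← sound eq with ≋.∈-resp-↭ C≋ K∈C
    ...   | here K≅L  = case L-positive , negative-resp-≅ K≅L K-negative of λ { (positive , ()) }
    ...   | there K∈D = D-unselected (Any.map (λ K≅M → MaybeU.just (≅.sym K≅M)) K∈D)

    rewriting⇒unit : ∀ {Q u t D} → Q ∈ᶜ R → Q ≋ (u ≈ t) ∷ D → NoneSelected (select Q) D →
                     D ≡ [] × ((u ≈ t) ∷ []) ∈ᶜ R
    rewriting⇒unit Q∈R Q≋ unsel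
      with l , r , refl ← ¬negative⇒unit (∈R⇒conditional Q∈R) (unselected⇒¬negative Q≋ positive unsel)
      with _ , refl , _ ← ≋-singleton⁻ (≋.sym Q≋) = refl , ∈ᶜ-resp-≋ Q≋ Q∈R

    -- Derived clauses have no positive literal, so the rewriting equation comes from `R`. The other
    -- premise is then a goal, since the premises must not all lie in `R`.
    step⇒consequence : ∀ {N N′} → Invariant N → Step R N N′ →
                       ∃[ D ] N′ ≡ D ∷ N × D ∉ᶜ N × Consequence N D
    step⇒consequence inv (step {Cs = []} (inj₁ refl) _ _ () _)
    step⇒consequence inv (step {Cs = _ ∷ []} (inj₁ refl) _ _ () _)
    step⇒consequence inv (step {Cs = _ ∷ _ ∷ _ ∷ _} (inj₁ refl) _ _ () _)
    step⇒consequence inv (step {Cs = P ∷ Q ∷ []} (inj₁ refl) (P∈N ∷ Q∈N ∷ []) ¬R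
        (rewriting {u₁ = u₁} {u₂} {u₃} ⋈ P≋ Q≋ E≋ _ _ unsel u≻t) E∉N)
      with origin inv P∈N | origin inv Q∈N
    ... | _          | inj₂ dQ =
      contradiction (≋.Any-resp-↭ positive-resp-≅ (≋.sym Q≋) (here positive)) (derived-¬positive dQ)
    ... | inj₁ P∈R   | inj₁ Q∈R = contradiction (P∈R ∷ Q∈R ∷ []) ¬R
    ... | inj₂ (solved P≋[] _) | inj₁ _ = contradiction (≋.trans (≋.sym P≋) P≋[]) ≋.¬x∷xs↭[]
    ... | inj₂ (goal P≋′ _ _)  | inj₁ Q∈R
      with refl , unit ← rewriting⇒unit Q∈R Q≋ unsel
      with _ , refl , L≅ ← ≋-singleton⁻ (≋.trans (≋.sym P≋) P≋′)
      -- The rewritten literal is the goal's only one, which fixes `⋈`.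
      with negative ← negative-resp-≅ (≅.sym L≅) negative =
      _ , refl , E∉N ,
      rewrites (∈ᶜ-resp-≋ P≋ P∈N) (↦-++ˡ u₁ (root (contract (unitRule u≻t unit) u₃ refl))) E≋
    step⇒consequence inv (step {Cs = []} (inj₂ refl) _ _ () _)
    step⇒consequence inv (step {Cs = _ ∷ _ ∷ _} (inj₂ refl) _ _ () _)
    step⇒consequence inv (step {Cs = P ∷ []} (inj₂ refl) (P∈N ∷ []) ¬R (equalityResolution P≋ _) E∉N)
      with origin inv P∈N
    ... | inj₁ P∈R = contradiction (P∈R ∷ []) ¬R
    ... | inj₂ (solved P≋[] _) = contradiction (≋.trans (≋.sym P≋) P≋[]) ≋.¬x∷xs↭[]
    ... | inj₂ (goal P≋′ _ _) with _ , refl , _ ← ≋-singleton⁻ (≋.trans (≋.sym P≋) P≋′) =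
      _ , refl , E∉N , resolve (∈ᶜ-resp-≋ P≋ P∈N) ≋.refl

    goal∉R : ∀ {u v} → ¬ (((u ≉ v) ∷ []) ∈ᶜ R)
    goal∉R g∈R = case positive∈R g∈R of λ { (here ()) ; (there ()) }

    goal-selected : ∀ u v → Selected (select ((u ≉ v) ∷ [])) (u ≉ v)
    goal-selected u v with select ((u ≉ v) ∷ []) in eq | total {(u ≉ v) ∷ []} (here negative)
    ... | just L | _ with here L≅ ← proj₂ (sound eq) = MaybeU.just (≅.sym L≅)

    ↦-context : ∀ {x y} → x ↦ y →
      ∃[ v ] ∃[ l ] ∃[ r ] ∃[ w ] x ≡ v ++ l ++ w × y ≡ v ++ r ++ w × UnitRule l r
    ↦-context (root (contract {l} {r} ρ w eq)) = [] , l , r , w , eq , refl , ρ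
    ↦-context (under a s) with v , l , r , w , refl , refl , ρ ← ↦-context s =
      a ∷ v , l , r , w , refl , refl , ρ

    -- Clauses of `R` contain a positive literal, so a goal premise is never in `R` and the
    -- inference is permitted.
    consequence⇒step : ∀ {N D} → Invariant N → Consequence N D → D ∉ᶜ N → Step R N (D ∷ N)
    consequence⇒step inv (resolve {u} g∈N D≋) D∉N =
      step (inj₂ refl) (g∈N ∷ []) (λ { (g∈R ∷ []) → goal∉R g∈R })
        (equalityResolution (≋.↭-prep (u ≉ u) (≋.sym D≋)) (goal-selected u u)) D∉N
    consequence⇒step inv (rewrites {v = v} g∈N s D≋) D∉N
      with v₁ , l , r , w , refl , refl , unitRule l≻r unit ← ↦-context s =
      step (inj₁ refl) (g∈N ∷ axioms inv unit ∷ []) (λ { (g∈R ∷ _) → goal∉R g∈R })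
        (rewriting {C = []} {D = []} {u₁ = v₁} {u₂ = l} {u₃ = w} negative ≋.refl ≋.refl D≋
          (λ _ → goal-selected _ v) (λ ()) (unselected (select-unit _ _) _) l≻r) D∉N

    goal-origin : ∀ {N u v} → Invariant N → ((u ≉ v) ∷ []) ∈ᶜ N →
                  (s ↦* u × t ↦* v) ⊎ (s ↦* v × t ↦* u)
    goal-origin inv g∈N with origin inv g∈N
    ... | inj₁ g∈R          = contradiction g∈R goal∉R
    ... | inj₂ (solved p _) = contradiction p ≋.¬x∷xs↭[]
    ... | inj₂ (goal p s↦* t↦*) with ≋-singleton⁻ p
    ...   | _ , refl , same = inj₁ (s↦* , t↦*)
    ...   | _ , refl , flip = inj₂ (s↦* , t↦*)

    consequence-derived : ∀ {N D} → Invariant N → Consequence N D → Derived D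
    consequence-derived inv (resolve g∈N D≋) with goal-origin inv g∈N
    ... | inj₁ (p , q) = solved D≋ (_ , p , q)
    ... | inj₂ (p , q) = solved D≋ (_ , p , q)
    consequence-derived inv (rewrites g∈N s D≋) with goal-origin inv g∈N
    ... | inj₁ (p , q) = goal D≋ (p ◅◅ s ◅ ε) q
    ... | inj₂ (p , q) = goal (≋.trans D≋ ≋-flip) p (q ◅◅ s ◅ ε)

    invariant-step : ∀ {N N′} → Invariant N → Step R N N′ → Invariant N′
    invariant-step inv st with D , refl , _ , c ← step⇒consequence inv st = record
      { axioms  = there ∘ axioms inv
      ; initial = there (initial inv)
      ; origin  = λ { (here p)    → inj₂ (derived-resp-≋ (≋.sym p) (consequence-derived inv c))
                    ; (there C∈N) → origin inv C∈N }
      }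
      where
      derived-resp-≋ : ∀ {C D} → C ≋ D → Derived C → Derived D
      derived-resp-≋ p (goal q s↦* t↦*) = goal (≋.trans (≋.sym p) q) s↦* t↦*
      derived-resp-≋ p (solved q j)     = solved (≋.trans (≋.sym p) q) j

    invariant-star : ∀ {N N′} → Invariant N → Star (Step R) N N′ → Invariant N′
    invariant-star inv ε        = inv
    invariant-star inv (st ◅ sts) = invariant-star (invariant-step inv st) sts

    -- Computing the consequences of goals

    resolvents : Str → Str → List (Clause Str)
    resolvents u v with u ≟ˢ v
    ... | yes _ = [] ∷ []
    ... | no _  = []

    goalConsequences : Clause Str → List (Clause Str)
    goalConsequences ((u ≉ v) ∷ []) =
      resolvents u v ++ map (λ u′ → (u′ ≉ v) ∷ []) (successors u)
                     -- The sides are exchanged here because `rewrites` is applied to the flipped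
                     -- goal.
                     ++ map (λ v′ → (v′ ≉ u) ∷ []) (successors v)
    goalConsequences _ = []

    goalConsequences-sound : ∀ {N C D} → C ∈ᶜ N → D ∈ goalConsequences C → Consequence N D
    goalConsequences-sound {C = (u ≉ v) ∷ []} C∈N D∈ with ∈.∈-++⁻ (resolvents u v) D∈
    ... | inj₁ D∈′ with u ≟ˢ v | D∈′
    ...   | yes refl | here refl = resolve C∈N ≋.refl
    ...   | no _     | ()
    goalConsequences-sound {C = (u ≉ v) ∷ []} C∈N D∈ | inj₂ D∈′
      with ∈.∈-++⁻ (map (λ u′ → (u′ ≉ v) ∷ []) (successors u)) D∈′
    ... | inj₁ D∈″ with _ , u′∈ , refl ← ∈.∈-map⁻ _ D∈″ = rewrites C∈N (successors-sound u′∈) ≋.refl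
    ... | inj₂ D∈″ with _ , v′∈ , refl ← ∈.∈-map⁻ _ D∈″ =
      rewrites (∈ᶜ-resp-≋ ≋-flip C∈N) (successors-sound v′∈) ≋.refl

    goalConsequences-resolve : ∀ u → [] ∈ goalConsequences ((u ≉ u) ∷ [])
    goalConsequences-resolve u with u ≟ˢ u
    ... | yes _  = here refl
    ... | no u≢u = contradiction refl u≢u

    goalConsequences-rewriteˡ : ∀ {u u′} v → u ↦ u′ → ((u′ ≉ v) ∷ []) ∈ goalConsequences ((u ≉ v) ∷ [])
    goalConsequences-rewriteˡ {u} v s =
      ∈.∈-++⁺ʳ (resolvents u v) (∈.∈-++⁺ˡ (∈.∈-map⁺ _ (successors-complete s)))

    goalConsequences-rewriteʳ : ∀ {v v′} u → v ↦ v′ → ((v′ ≉ u) ∷ []) ∈ goalConsequences ((u ≉ v) ∷ [])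
    goalConsequences-rewriteʳ {v} u s =
      ∈.∈-++⁺ʳ (resolvents u v)
        (∈.∈-++⁺ʳ (map (λ u′ → (u′ ≉ v) ∷ []) (successors u)) (∈.∈-map⁺ _ (successors-complete s)))

    goalConsequences-complete : ∀ {N D} → Consequence N D →
                                ∃[ E ] E ∈ concatMap goalConsequences N × D ≋ E
    goalConsequences-complete (resolve {u} g∈N D≋) =
      _ , ∈.∈-concatMap⁺ goalConsequences (Any.map found g∈N) , D≋
      where
      found : ∀ {C} → ((u ≉ u) ∷ []) ≋ C → [] ∈ goalConsequences C
      found p with ≋-singleton⁻ (≋.sym p)
      ... | _ , refl , same = goalConsequences-resolve u
      ... | _ , refl , flip = goalConsequences-resolve u
    goalConsequences-complete (rewrites {u} {u′} {v} g∈N s D≋) =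
      _ , ∈.∈-concatMap⁺ goalConsequences (Any.map found g∈N) , D≋
      where
      found : ∀ {C} → ((u ≉ v) ∷ []) ≋ C → ((u′ ≉ v) ∷ []) ∈ goalConsequences C
      found p with ≋-singleton⁻ (≋.sym p)
      ... | _ , refl , same = goalConsequences-rewriteˡ v s
      ... | _ , refl , flip = goalConsequences-rewriteʳ v s

    -- A step exists exactly when one of the finitely many listed consequences is missing from `N`.
    step? : ∀ {N} → Invariant N → Dec (∃ (Step R N))
    step? {N} inv with Any.any? (λ D → ¬? (D ∈ᶜ? N)) (concatMap goalConsequences N)
    ... | yes p with D , D∈ , D∉N ← find p
                with C , C∈N , D∈C ← find (∈.∈-concatMap⁻ goalConsequences {xs = N} D∈) =
      yes (_ , consequence⇒step inv (goalConsequences-sound (Any.map ≋.reflexive C∈N) D∈C) D∉N)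
    ... | no ¬p = no λ (_ , st) → case step⇒consequence inv st of λ
      { (D , refl , D∉N , c) → case goalConsequences-complete c of λ
        { (E , E∈ , D≋E) → ¬p (lose E∈ (D∉N ∘ ∈ᶜ-resp-≋ (≋.sym D≋E))) } }

    -- Termination of the search

    candidates : List (Clause Str)
    candidates = [] ∷
      cartesianProductWith (λ u v → (u ≉ v) ∷ []) (wordsUpTo (length s)) (wordsUpTo (length t))

    -- Oriented steps never lengthen a word, so the sides of a goal stay within the lengths of `s`
    -- and `t`.
    derived⇒candidate : ∀ {C} → Derived C → C ∈ᶜ candidates
    derived⇒candidate (solved p _) = here p
    derived⇒candidate (goal p s↦*u t↦*v) = there (Any.map (λ { refl → p })
      (∈.∈-cartesianProductWith⁺ _ (∈-wordsUpTo (↦*⇒length≤ s↦*u)) (∈-wordsUpTo (↦*⇒length≤ t↦*v))))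

    -- Every step adds a clause that `N` lacked, and this clause can be struck from the finite list
    -- of candidates.
    terminates : Terminates R s t
    terminates = go _ candidates refl invariant-start (inj₁ ∘ derived⇒candidate)
      where
      open Permutationₚ (clauseSetoid Str) using (xs↭ys⇒|xs|≡|ys|; ∈-resp-↭)
      -- remaining lists the candidates that N may still lack.
      go : ∀ n remaining {N} → length remaining ≡ n → Invariant N →
           (∀ {C} → Derived C → C ∈ᶜ remaining ⊎ C ∈ᶜ N) → Acc (λ N′ N → Step R N N′) N
      go n remaining {N} len inv covered = acc below
        where
        below : ∀ {N′} → Step R N N′ → Acc (λ N′ N → Step R N N′) N′
        below st with D , refl , D∉N , c ← step⇒consequence inv st with covered (consequence-derived inv c)
        ... | inj₂ D∈N = contradiction D∈N D∉N
        ... | inj₁ D∈remaining with remaining′ , p ← ∈⇒↭∷ (clauseSetoid Str) D∈remaining = shorter n len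
          where
          covered′ : ∀ {C} → Derived C → C ∈ᶜ remaining′ ⊎ C ∈ᶜ (D ∷ N)
          covered′ dC with covered dC
          ... | inj₂ C∈N = inj₂ (there C∈N)
          ... | inj₁ C∈  with ∈-resp-↭ p C∈
          ...   | here C≋D  = inj₂ (here C≋D)
          ...   | there C∈′ = inj₁ C∈′
          -- `n` makes the recursion structural; it cannot be zero because `remaining` contains `D`.
          shorter : ∀ n → length remaining ≡ n → Acc (λ N′ N → Step R N N′) (D ∷ N)
          shorter zero    len = case trans (sym len) (xs↭ys⇒|xs|≡|ys| p) of λ ()
          shorter (suc n) len = go n remaining′ (ℕₚ.suc-injective (trans (sym (xs↭ys⇒|xs|≡|ys| p)) len))
                                   (invariant-step inv st) covered′

    -- Exhaustive derivations decide entailment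

    result : ∃ (Result R s t)
    result = go invariant-start terminates
      where
      go : ∀ {N} → Invariant N → Acc (λ N′ N → Step R N N′) N →
           ∃[ N′ ] Star (Step R) N N′ × IsNormalForm (Step R) N′
      go {N} inv (acc rs) with step? inv
      ... | no nf        = N , ε , nf
      ... | yes (_ , st) with N′ , sts , nf ← go (invariant-step inv st) (rs st) = N′ , st ◅ sts , nf

    result-decides : Saturated (_∈ᶜ R) → ∀ N → Result R s t N → ([] ∈ᶜ N ⇔ ((_∈ᶜ R) ⊨ ((s ≈ t) ∷ [])))
    result-decides saturated N (sts , nf) = mk⇔ to from
      where
      inv = invariant-star invariant-start sts

      to : [] ∈ᶜ N → (_∈ᶜ R) ⊨ ((s ≈ t) ∷ [])
      to []∈N with origin inv []∈N
      ... | inj₁ []∈R         = case positive∈R []∈R of λ ()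
      ... | inj₂ (goal p _ _) = contradiction (≋.sym p) ≋.¬x∷xs↭[]
      ... | inj₂ (solved _ j) = joinable⇒⊨ j

      closed : ∀ {D} → Consequence N D → D ∈ᶜ N
      -- Normality only refutes the absence of `D`; decidable membership turns this into presence.
      closed {D} c = decidable-stable (D ∈ᶜ? N) λ D∉N → nf (_ , consequence⇒step inv c D∉N)

      rewrites* : ∀ {u u′ v} → u ↦* u′ → ((u ≉ v) ∷ []) ∈ᶜ N → ((u′ ≉ v) ∷ []) ∈ᶜ N
      rewrites* ε        g∈N = g∈N
      rewrites* (s ◅ ss) g∈N = rewrites* ss (closed (rewrites g∈N s ≋.refl))

      from : (_∈ᶜ R) ⊨ ((s ≈ t) ∷ []) → [] ∈ᶜ N
      from R⊨s≈t with u , s↦*u , t↦*u ← ⊨⇒joinable saturated R⊨s≈t =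
        -- The left side is taken from `s` to `u`; after a flip, `t` is taken to `u` as well, and
        -- the goal `u ≉ u` resolves.
        closed (resolve (rewrites* t↦*u (∈ᶜ-resp-≋ ≋-flip (rewrites* s↦*u (initial inv)))) ≋.refl)

theorem22 : (𝒜 : Alphabet) → let open Calculus 𝒜 in
    (selection : SelectionFunction) → let open WithSelection selection in
    (R : List (Clause Str)) →
    All IsConditionalEquation R →
    Saturated (_∈ᶜ R) →
    (s t : Str) →
    Dec ((_∈ᶜ R) ⊨ ((s ≈ t) ∷ []))
    × Terminates R s t
    × ∃ (Result R s t)
    × (∀ N → Result R s t N → ([] ∈ᶜ N ⇔ ((_∈ᶜ R) ⊨ ((s ≈ t) ∷ []))))
theorem22 𝒜 selection R R-conditional saturated s t =
  -- One computed result suffices: entailment is read off from the presence of the empty clause.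
  (let N , N-result = result
       decides      = result-decides saturated N N-result
   in map′ (Equivalence.to decides) (Equivalence.from decides) ([] ∈ᶜ? N))
  , terminates , result , result-decides saturated
  where
  open Words 𝒜
  open Theory 𝒜 selection R R-conditional
  open Search s t
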